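{- For every $n$, there exist complete structured d-DNNF $D_1,\dots,D_n$ on a variable set $X$ with $|X|=O(n)$, all with the same vtree $T$ and each of width $2$, such that $\bigwedge_{i=1}^n D_i$ cannot be represented by a complete structured DNNF of width smaller than $2^{\Omega(n)}$. Moreover, $\bigvee_{i=1}^n\neg D_i$ can be represented by a complete structured DNNF of width $O(n)$, and every complete structured DNNF representing it has width $\Omega(n)$.
   Context: A DNNF is a Boolean circuit with $\wedge$- and $\vee$-gates over literal inputs (negation only at inputs) in which every $\wedge$-gate is decomposable (its inputs' subcircuits are on disjoint variables); it is deterministic (d-DNNF) if no assignment makes two inputs of an $\vee$-gate true. A vtree for $X$ is a rooted tree in which every non-leaf node has exactly two children and whose leaves are in bijection with $X$. A complete structured DNNF $(D,T,\lambda)$ is a DNNF $D$, a vtree $T$ for $\mathsf{var}(D)$, and a map $\lambda$ assigning to each node $t$ a set $\lambda(t)$ of gates such that: each gate $u$ lies in $\lambda(t_u)$ for a unique node $t_u$; a leaf labeled $x$ receives only inputs $x,\neg x$; non-leaf nodes receive no inputs; every $\wedge$-gate has two inputs $v_1,v_2$ with $t_{v_1}\neq t_{v_2}$; for every wire from $u$ into $v$, either $v$ is an $\wedge$-gate, $u$ an $\vee$-gate or input and $t_u$ a child of $t_v$, or $v$ is an $\vee$-gate, $u$ an $\wedge$-gate and $t_u=t_v$. It is a complete structured d-DNNF if $D$ is deterministic. Its width is the maximum over $t$ of the number of $\vee$-gates in $\lambda(t)$. -}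

module Defs where

open import Data.Nat using (ℕ; zero; suc; _≤_)
open import Data.Fin using (Fin; zero; suc) renaming (_<_ to _<ᶠ_)
open import Data.Fin.Induction using (<-wellFounded)
open import Data.Bool using (Bool; true; false; _∧_; _∨_; not; if_then_else_)
open import Data.List using (List; []; _∷_; length; filterᵇ; allFin)
open import Data.List.Membership.Propositional using (_∈_)
open import Data.List.Relation.Unary.Any using (here; there)
open import Data.Product using (Σ; ∃; _×_; _,_)
open import Data.Sum using (_⊎_)
open import Data.Empty using (⊥)
open import Relation.Nullary using (¬_; Dec; yes; no)
open import Relation.Nullary.Decidable using (⌊_⌋)
open import Relation.Binary.PropositionalEquality using (_≡_; _≢_; refl; cong)
open import Induction.WellFounded using (Acc; acc)

-- Circuits over the variable set X = Fin m.
-- A circuit is a DAG whose gates are numbered 0 .. size-1 in a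
-- topological order (every input of gate u has a smaller number).
-- (input x true) is the literal x, (input x false) is the literal ¬x.

data Gate (m s : ℕ) : Set where
  input    : Fin m → Bool → Gate m s
  and-gate : List (Fin s) → Gate m s
  or-gate  : List (Fin s) → Gate m s

inputsOf : ∀ {m s} → Gate m s → List (Fin s)
inputsOf (input _ _)   = []
inputsOf (and-gate vs) = vs
inputsOf (or-gate vs)  = vs

isInput isAnd isOr : ∀ {m s} → Gate m s → Bool
isInput (input _ _)  = true
isInput (and-gate _) = false
isInput (or-gate _)  = false
isAnd (input _ _)  = false
isAnd (and-gate _) = true
isAnd (or-gate _)  = false
isOr (input _ _)  = false
isOr (and-gate _) = false
isOr (or-gate _)  = true

record Circuit (m : ℕ) : Set where
  field
    size    : ℕ
    gate    : Fin size → Gate m size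
    acyclic : ∀ u v → v ∈ inputsOf (gate u) → v <ᶠ u
    output  : Fin size

open Circuit public

andL : ∀ {A : Set} (xs : List A) → (∀ {x} → x ∈ xs → Bool) → Bool
andL []       r = true
andL (x ∷ xs) r = r (here refl) ∧ andL xs (λ p → r (there p))

orL : ∀ {A : Set} (xs : List A) → (∀ {x} → x ∈ xs → Bool) → Bool
orL []       r = false
orL (x ∷ xs) r = r (here refl) ∨ orL xs (λ p → r (there p))

module Evaluation {m : ℕ} (C : Circuit m) (a : Fin m → Bool) where

  evalGate : (g : Gate m (size C)) → (∀ {v} → v ∈ inputsOf g → Bool) → Bool
  evalGate (input x b)   _ = if b then a x else not (a x)
  evalGate (and-gate vs) r = andL vs r
  evalGate (or-gate vs)  r = orL vs r

  evalAcc : (u : Fin (size C)) → Acc _<ᶠ_ u → Bool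
  evalAcc u (acc rs) =
    evalGate (gate C u) (λ {v} p → evalAcc v (rs (acyclic C u v p)))

  value : Fin (size C) → Bool
  value u = evalAcc u (<-wellFounded u)

valueAt : ∀ {m} (C : Circuit m) → (Fin m → Bool) → Fin (size C) → Bool
valueAt C a = Evaluation.value C a

eval : ∀ {m} (C : Circuit m) → (Fin m → Bool) → Bool
eval C a = valueAt C a (output C)

data Reach {m} (C : Circuit m) : Fin (size C) → Fin (size C) → Set where
  reach-refl : ∀ {u} → Reach C u u
  reach-step : ∀ {u v w} → v ∈ inputsOf (gate C u) → Reach C v w → Reach C u w

VarIn : ∀ {m} (C : Circuit m) → Fin (size C) → Fin m → Set
VarIn C u x = ∃ λ w → Reach C u w × ∃ λ b → gate C w ≡ input x b

VarOf : ∀ {m} (C : Circuit m) → Fin m → Set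
VarOf C x = ∃ λ w → ∃ λ b → gate C w ≡ input x b

Decomposable : ∀ {m} → Circuit m → Set
Decomposable C = ∀ u vs → gate C u ≡ and-gate vs →
  ∀ v₁ v₂ → v₁ ∈ vs → v₂ ∈ vs → v₁ ≢ v₂ →
  ∀ x → VarIn C v₁ x → VarIn C v₂ x → ⊥

Deterministic : ∀ {m} → Circuit m → Set
Deterministic C = ∀ u vs → gate C u ≡ or-gate vs →
  ∀ v₁ v₂ → v₁ ∈ vs → v₂ ∈ vs → v₁ ≢ v₂ →
  ∀ a → valueAt C a v₁ ≡ true → valueAt C a v₂ ≡ true → ⊥

data VTree (m : ℕ) : Set where
  leaf : Fin m → VTree m
  node : VTree m → VTree m → VTree m

data Node {m : ℕ} : VTree m → Set where
  root  : ∀ {t} → Node t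
  left  : ∀ {l r} → Node l → Node (node l r)
  right : ∀ {l r} → Node r → Node (node l r)

subtree : ∀ {m} {t : VTree m} → Node t → VTree m
subtree {t = t} root = t
subtree (left p)  = subtree p
subtree (right p) = subtree p

data ChildOf {m : ℕ} : {t : VTree m} → Node t → Node t → Set where
  c-left   : ∀ {l r} → ChildOf {t = node l r} (left root) root
  c-right  : ∀ {l r} → ChildOf {t = node l r} (right root) root
  in-left  : ∀ {l r} {p q : Node l} → ChildOf p q → ChildOf {t = node l r} (left p) (left q)
  in-right : ∀ {l r} {p q : Node r} → ChildOf p q → ChildOf {t = node l r} (right p) (right q)

left-inj : ∀ {m} {l r : VTree m} {p q : Node l} → left {r = r} p ≡ left q → p ≡ q
left-inj refl = refl

right-inj : ∀ {m} {l r : VTree m} {p q : Node r} → right {l = l} p ≡ right q → p ≡ q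
right-inj refl = refl

_≟N_ : ∀ {m} {t : VTree m} (p q : Node t) → Dec (p ≡ q)
root    ≟N root    = yes refl
root    ≟N left q  = no λ ()
root    ≟N right q = no λ ()
left p  ≟N root    = no λ ()
left p  ≟N left q  with p ≟N q
... | yes refl = yes refl
... | no ne    = no λ e → ne (left-inj e)
left p  ≟N right q = no λ ()
right p ≟N root    = no λ ()
right p ≟N left q  = no λ ()
right p ≟N right q with p ≟N q
... | yes refl = yes refl
... | no ne    = no λ e → ne (right-inj e)

IsVTreeFor : ∀ {m} → VTree m → (Fin m → Set) → Set
IsVTreeFor T S =
  (∀ (p q : Node T) x → subtree p ≡ leaf x → subtree q ≡ leaf x → p ≡ q) ×
  (∀ x → (S x → ∃ λ (p : Node T) → subtree p ≡ leaf x) ×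
         ((∃ λ (p : Node T) → subtree p ≡ leaf x) → S x))

-- Complete structured DNNF.  The labelling λ is given by the map
-- place : gates → nodes,  λ(t) = { u | place u ≡ t }  (so t_u = place u).

record IsCompleteStructured {m} (C : Circuit m) (T : VTree m)
                            (place : Fin (size C) → Node T) : Set where
  field
    decomposable : Decomposable C
    vtree-for    : IsVTreeFor T (VarOf C)
    leaf-gates   : ∀ u x → subtree (place u) ≡ leaf x → ∃ λ b → gate C u ≡ input x b
    inputs-at-leaves : ∀ u x b → gate C u ≡ input x b → ∃ λ y → subtree (place u) ≡ leaf y
    and-fanin    : ∀ u vs → gate C u ≡ and-gate vs →
                   ∃ λ v₁ → ∃ λ v₂ → vs ≡ v₁ ∷ v₂ ∷ [] × place v₁ ≢ place v₂
    wires        : ∀ v u → u ∈ inputsOf (gate C v) →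
                   (isAnd (gate C v) ≡ true ×
                    (isOr (gate C u) ≡ true ⊎ isInput (gate C u) ≡ true) ×
                    ChildOf (place u) (place v))
                   ⊎
                   (isOr (gate C v) ≡ true × isAnd (gate C u) ≡ true × place u ≡ place v)

record CSDNNF (m : ℕ) (T : VTree m) : Set where
  field
    circuit    : Circuit m
    place      : Fin (size circuit) → Node T
    structured : IsCompleteStructured circuit T place

open CSDNNF public

IsDeterministic : ∀ {m} {T : VTree m} → CSDNNF m T → Set
IsDeterministic D = Deterministic (circuit D)

orCount : ∀ {m} {T : VTree m} → CSDNNF m T → Node T → ℕ
orCount D t = length (filterᵇ (λ u → isOr (gate (circuit D) u) ∧ ⌊ place D u ≟N t ⌋)
                              (allFin (size (circuit D))))

HasWidth : ∀ {m} {T : VTree m} → CSDNNF m T → ℕ → Set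
HasWidth {T = T} D w = (∀ (t : Node T) → orCount D t ≤ w) × (∃ λ (t : Node T) → orCount D t ≡ w)

Represents : ∀ {m} {T : VTree m} → CSDNNF m T → ((Fin m → Bool) → Bool) → Set
Represents D f = ∀ a → eval (circuit D) a ≡ f a

⋀ : (n : ℕ) → (Fin n → Bool) → Bool
⋀ zero    g = true
⋀ (suc n) g = g zero ∧ ⋀ n (λ i → g (suc i))

⋁ : (n : ℕ) → (Fin n → Bool) → Bool
⋁ zero    g = false
⋁ (suc n) g = g zero ∨ ⋁ n (λ i → g (suc i))

conjOf : ∀ {m n} {T : VTree m} → (Fin n → CSDNNF m T) → (Fin m → Bool) → Bool
conjOf {n = n} D a = ⋀ n (λ i → eval (circuit (D i)) a)

disjNegOf : ∀ {m n} {T : VTree m} → (Fin n → CSDNNF m T) → (Fin m → Bool) → Bool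
disjNegOf {n = n} D a = ⋁ n (λ i → not (eval (circuit (D i)) a))

{-# OPTIONS --safe #-}
module Submission where

-- The variables are z (one per column of a Boolean matrix M), x (one per row)
-- and one more variable y, and D i says that (M z) i ∨ x i has the value y. A
-- two-state automaton evaluates this in one pass over the variables, and such
-- an automaton is a structured d-DNNF of width 2 over a comb; guessing i first
-- gives a small DNNF for the disjunction of the negations.
--
-- For the lower bounds, cut the vtree of a structured DNNF at a node t that
-- holds a balanced part of the x. The or-gates at t cover the function by
-- rectangles. Majority puts many columns C on one side of the cut and many rows
-- R on the other, so if M restricted to R × C has rank at least r then the 2 ^ r
-- values of M z on R form a fooling set. Hence the conjunction needs 2 ^ r
-- rectangles; and since w rectangles for the negation split each side into at
-- most 2 ^ w classes, the disjunction needs r.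
--
-- A matrix all of whose large submatrices have linear rank exists by counting:
-- for fixed R, C and a rank factorisation P · Q, the matrices agreeing with P · Q
-- on R × C are a subcube, and the total volume of these subcubes is too small to
-- cover all matrices.

-- The lower bounds range over all vtrees, so the cut is not under control and one `M` must be hard
-- for every cut that splits the `x` evenly; this is why all large submatrices need high rank, not
-- just one. The counting has room for this: a description of `R`, `C`, `P` and `Q` takes
-- `(2 * n + 1) * (r + 1)` bits, while agreement with `P · Q` on `R × C` fixes at least `θ * θ`
-- entries. If `θ` is a constant fraction of `n`, so may be `r`.
--
-- The variables `x` transport the rows across the cut. When the columns lie on one side, `x i` on
-- the other side has to be compared with a bit of `M z` that only the first side knows, and each
-- row of a high-rank submatrix is such a comparison.
--
-- Comparing with `y` makes the clauses self-complementary: the negation of `D i` is the same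
-- automaton with the accepting literals flipped, so a single guess of `i` is all that the
-- disjunction costs.

open import Defs
open import Algebra.Bundles using (CommutativeRing)
open import Data.Bool as Bool using (Bool; true; false; _∧_; _∨_; not; if_then_else_; _xor_; T)
open import Data.Bool.ListAction using (any; all)
open import Data.Bool.Properties using (xor-∧-commutativeRing; ∧-zeroʳ; ∧-identityʳ; ¬-not; ∨-zeroʳ; T-≡; T-∧; not-¬; ∨-identityʳ; ∨-assoc; xor-assoc; not-injective)
open import Data.Empty using (⊥)
open import Data.Fin using (Fin; zero; suc; combine; _↑ˡ_; _↑ʳ_; splitAt; remQuot; finToFun; funToFin; fromℕ; inject₁; opposite; toℕ) renaming (_<_ to _<ᶠ_)
open import Data.Fin.Induction using (<-wellFounded; >-weakInduction)
open import Data.Fin.Properties using (splitAt-↑ˡ; splitAt-↑ʳ; finToFun-funToFin; remQuot-combine; combine-remQuot; 2↔Bool; any?; _≟_; pigeonhole; splitAt⁻¹-↑ˡ; splitAt⁻¹-↑ʳ; opposite-involutive; opposite-prop; toℕ-↑ˡ; toℕ-↑ʳ; toℕ-combine; toℕ<n; toℕ-inject₁; combine-monoˡ-<; inject₁-injective; ↑ʳ-injective) renaming (<⇒≢ to <ᶠ⇒≢; suc-injective to suc-injectiveᶠ)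
open import Data.Fin.Relation.Unary.Top using (view; ‵fromℕ; ‵inject₁; view-fromℕ; view-inject₁)
open import Data.List as List using (List; []; _∷_; length; filter; allFin; filterᵇ)
open import Data.List.Membership.Propositional using (_∈_)
open import Data.List.Membership.Propositional.Properties using (∈-map⁺; ∈-map⁻; ∈-filter⁺; ∈-filter⁻; ∈-allFin; ∈-lookup)
open import Data.List.Membership.Propositional.Properties.WithK using (unique∧set⇒bag)
open import Data.List.Properties using (length-filter; length-map; length-tabulate)
open import Data.List.Relation.Binary.BagAndSetEquality using (∼bag⇒↭)
open import Data.List.Relation.Binary.Permutation.Propositional.Properties using (↭-length)
open import Data.List.Relation.Unary.Any using (here; there; index)
open import Data.List.Relation.Unary.Any.Properties using (lookup-index)
open import Data.List.Relation.Unary.Unique.Propositional.Properties using (map⁺; filter⁺; allFin⁺)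
open import Data.Maybe using (Maybe; just; nothing)
open import Data.Nat using (ℕ; zero; suc; _+_; _*_; _^_; _≤_; _<_; z≤n; s≤s; _≤?_; _<?_; _∸_)
open import Data.Nat.DivMod using (_/_; _%_; m≡m%n+[m/n]*n; m%n<n; /-monoˡ-≤)
open import Data.Nat.ListAction using (sum)
open import Data.Nat.Properties hiding (_≟_)
open import Data.Nat.Tactic.RingSolver using (solve-∀)
open import Data.Product using (Σ; ∃; _×_; _,_; proj₁; proj₂; uncurry)
open import Data.Sum using (_⊎_; inj₁; inj₂; [_,_]′)
open import Data.Vec using (Vec; []; _∷_; lookup; tabulate; concat; _++_)
open import Data.Vec.Properties using (lookup-concat; lookup∘tabulate)
open import Function using (_∘_; id; Inverse; Equivalence; mk⇔)
open import Induction.WellFounded using (Acc; acc)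
open import Relation.Binary.PropositionalEquality
open import Relation.Nullary using (¬_; Dec; yes; no; contradiction; does)
open import Relation.Nullary.Decidable using (_×-dec_; ⌊_⌋; T?; dec-true; toWitness; fromWitness; dec-false)
open import Algebra.Properties.Semiring.Sum (CommutativeRing.semiring xor-∧-commutativeRing) using (∑-distrib-+; sum-cong-≗; *-distribˡ-sum) renaming (sum to ⨁)

-- Subcubes of the Boolean cube

-- An entry just b fixes a coordinate and nothing leaves it free; the weight is
-- then the number of points of the subcube.
weight : ∀ {L} → Vec (Maybe Bool) L → ℕ
weight []            = 1
weight (nothing ∷ c) = 2 * weight c
weight (just _  ∷ c) = weight c

volume : ∀ {L} → List (Vec (Maybe Bool) L) → ℕ
volume = sum ∘ List.map weight

Match : ∀ {L} → Vec (Maybe Bool) L → Vec Bool L → Set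
Match c v = ∀ i b → lookup c i ≡ just b → lookup v i ≡ b

slice : ∀ {L} → Bool → List (Vec (Maybe Bool) (suc L)) → List (Vec (Maybe Bool) L)
slice b     []                       = []
slice b     ((nothing    ∷ c) ∷ cs)  = c ∷ slice b cs
slice true  ((just true  ∷ c) ∷ cs)  = c ∷ slice true cs
slice true  ((just false ∷ c) ∷ cs)  = slice true cs
slice false ((just true  ∷ c) ∷ cs)  = slice false cs
slice false ((just false ∷ c) ∷ cs)  = c ∷ slice false cs

-- A free first coordinate doubles the weight and puts the tail into both slices; a fixed one keeps
-- the weight and puts the tail into one slice. Halving the cube thus conserves volume, and one half
-- carries at most half of it.
volume-slice : ∀ {L} (cs : List (Vec (Maybe Bool) (suc L))) →
  volume cs ≡ volume (slice true cs) + volume (slice false cs)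
volume-slice []                      = refl
volume-slice ((nothing    ∷ c) ∷ cs) rewrite volume-slice cs =
  rearrange (weight c) (volume (slice true cs)) (volume (slice false cs))
  where
  rearrange : ∀ x y z → 2 * x + (y + z) ≡ (x + y) + (x + z)
  rearrange = solve-∀
volume-slice ((just true  ∷ c) ∷ cs) rewrite volume-slice cs = sym (+-assoc (weight c) _ _)
volume-slice ((just false ∷ c) ∷ cs) rewrite volume-slice cs =
  rearrange (weight c) (volume (slice true cs)) (volume (slice false cs))
  where
  rearrange : ∀ x y z → x + (y + z) ≡ y + (x + z)
  rearrange = solve-∀

slice-match : ∀ {L} b (v : Vec Bool L) cs {c} → c ∈ cs → Match c (b ∷ v) →
  ∃ λ c′ → c′ ∈ slice b cs × Match c′ v
slice-match b     v ((nothing    ∷ c) ∷ cs) (here refl) mt = c , here refl , mt ∘ suc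
slice-match true  v ((just true  ∷ c) ∷ cs) (here refl) mt = c , here refl , mt ∘ suc
slice-match true  v ((just false ∷ c) ∷ cs) (here refl) mt with () ← mt zero false refl
slice-match false v ((just true  ∷ c) ∷ cs) (here refl) mt with () ← mt zero true refl
slice-match false v ((just false ∷ c) ∷ cs) (here refl) mt = c , here refl , mt ∘ suc
slice-match b     v ((nothing    ∷ c) ∷ cs) (there p)   mt
  with c′ , q , mt′ ← slice-match b v cs p mt = c′ , there q , mt′
slice-match true  v ((just true  ∷ c) ∷ cs) (there p)   mt
  with c′ , q , mt′ ← slice-match true v cs p mt = c′ , there q , mt′
slice-match true  v ((just false ∷ c) ∷ cs) (there p)   mt = slice-match true v cs p mt
slice-match false v ((just true  ∷ c) ∷ cs) (there p)   mt = slice-match false v cs p mt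
slice-match false v ((just false ∷ c) ∷ cs) (there p)   mt
  with c′ , q , mt′ ← slice-match false v cs p mt = c′ , there q , mt′

-- Fix the bits one after the other, each time moving to the half cube in
-- which the subcubes have the smaller total volume.
uncovered : ∀ L (cs : List (Vec (Maybe Bool) L)) → volume cs < 2 ^ L →
  ∃ λ v → ∀ {c} → c ∈ cs → ¬ Match c v
uncovered zero    []        lt       = [] , λ ()
uncovered zero    ([] ∷ cs) (s≤s ())
uncovered (suc L) cs        lt = [ extend true , extend false ]′ smaller
  where
  extend : ∀ b → volume (slice b cs) < 2 ^ L → ∃ λ v → ∀ {c} → c ∈ cs → ¬ Match c v
  extend b lt′ with v , avoids ← uncovered L (slice b cs) lt′ =
    b ∷ v , λ p mt → let _ , q , mt′ = slice-match b v cs p mt in avoids q mt′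

  open ≤-Reasoning
  smaller : volume (slice true cs) < 2 ^ L ⊎ volume (slice false cs) < 2 ^ L
  smaller with volume (slice true cs) <? 2 ^ L
  ... | yes lt₁ = inj₁ lt₁
  ... | no  ge  = inj₂ (+-cancelˡ-< (2 ^ L) _ _ (begin-strict
    2 ^ L + volume (slice false cs)                    ≤⟨ +-monoˡ-≤ _ (≮⇒≥ ge) ⟩
    volume (slice true cs) + volume (slice false cs)   ≡⟨ volume-slice cs ⟨
    volume cs                                          <⟨ lt ⟩
    2 ^ L + (2 ^ L + 0)                                ≡⟨ cong (2 ^ L +_) (+-identityʳ _) ⟩
    2 ^ L + 2 ^ L                                      ∎))

cnt : ∀ {n} → (Fin n → Bool) → ℕ
cnt {zero}  p = 0
cnt {suc n} p = (if p zero then 1 else 0) + cnt (p ∘ suc)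

cnt-cong : ∀ {n} {p p′ : Fin n → Bool} → p ≗ p′ → cnt p ≡ cnt p′
cnt-cong {zero}  eq = refl
cnt-cong {suc n} eq = cong₂ (λ b k → (if b then 1 else 0) + k) (eq zero) (cnt-cong (eq ∘ suc))

weight-++ : ∀ {K L} (c : Vec (Maybe Bool) K) (d : Vec (Maybe Bool) L) →
  weight (c ++ d) ≡ weight c * weight d
weight-++ []            d = sym (+-identityʳ _)
weight-++ (nothing ∷ c) d rewrite weight-++ c d = sym (*-assoc 2 (weight c) (weight d))
weight-++ (just _  ∷ c) d = weight-++ c d

row : ∀ {q} → Bool → (Fin q → Bool) → (Fin q → Bool) → Vec (Maybe Bool) q
row r C x = tabulate λ j → if r ∧ C j then just (x j) else nothing

weight-row : ∀ {q} r (C x : Fin q → Bool) →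
  weight (row r C x) * 2 ^ ((if r then 1 else 0) * cnt C) ≡ 2 ^ q
weight-row {zero}  true  C x = refl
weight-row {zero}  false C x = refl
weight-row {suc q} false C x = trans (*-assoc 2 (weight (row false (C ∘ suc) (x ∘ suc))) 1)
                                     (cong (2 *_) (weight-row false (C ∘ suc) (x ∘ suc)))
weight-row {suc q} true  C x with C zero
... | true  = trans (rearrange (weight (row true (C ∘ suc) (x ∘ suc))) (2 ^ (cnt (C ∘ suc) + 0)))
                    (cong (2 *_) (weight-row true (C ∘ suc) (x ∘ suc)))
  where
  rearrange : ∀ a b → a * (2 * b) ≡ 2 * (a * b)
  rearrange = solve-∀
... | false = trans (*-assoc 2 (weight (row true (C ∘ suc) (x ∘ suc))) _)
                    (cong (2 *_) (weight-row true (C ∘ suc) (x ∘ suc)))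

cube : ∀ {n q} → (Fin n → Bool) → (Fin q → Bool) → (Fin n → Fin q → Bool) → Vec (Maybe Bool) (n * q)
cube R C B = concat (tabulate λ i → row (R i) C (B i))

-- Exactly `cnt R * cnt C` entries are fixed. The product form avoids a subtraction in the exponent.
weight-cube : ∀ {n q} (R : Fin n → Bool) (C : Fin q → Bool) B →
  weight (cube R C B) * 2 ^ (cnt R * cnt C) ≡ 2 ^ (n * q)
weight-cube {zero}      R C B = refl
weight-cube {suc n} {q} R C B = begin
  weight (row (R zero) C (B zero) ++ rest) * 2 ^ ((ρ + cnt (R ∘ suc)) * cnt C)
    ≡⟨ cong₂ _*_ (weight-++ (row (R zero) C (B zero)) rest)
         (trans (cong (2 ^_) (*-distribʳ-+ (cnt C) ρ _)) (^-distribˡ-+-* 2 (ρ * cnt C) _)) ⟩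
  weight (row (R zero) C (B zero)) * weight rest * (2 ^ (ρ * cnt C) * 2 ^ (cnt (R ∘ suc) * cnt C))
    ≡⟨ interchange (weight (row (R zero) C (B zero))) (weight rest) _ _ ⟩
  weight (row (R zero) C (B zero)) * 2 ^ (ρ * cnt C) * (weight rest * 2 ^ (cnt (R ∘ suc) * cnt C))
    ≡⟨ cong₂ _*_ (weight-row (R zero) C (B zero)) (weight-cube (R ∘ suc) C (B ∘ suc)) ⟩
  2 ^ q * 2 ^ (n * q)
    ≡⟨ ^-distribˡ-+-* 2 q (n * q) ⟨
  2 ^ (q + n * q) ∎
  where
  open ≡-Reasoning
  ρ = if R zero then 1 else 0
  rest = cube (R ∘ suc) C (B ∘ suc)
  interchange : ∀ a b c d → a * b * (c * d) ≡ a * c * (b * d)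
  interchange = solve-∀

lookup-cube : ∀ {n q} (R : Fin n → Bool) (C : Fin q → Bool) B i j →
  lookup (cube R C B) (combine i j) ≡ (if R i ∧ C j then just (B i j) else nothing)
lookup-cube R C B i j = begin
  lookup (cube R C B) (combine i j)                         ≡⟨ lookup-concat (tabulate λ i → row (R i) C (B i)) i j ⟩
  lookup (lookup (tabulate λ i → row (R i) C (B i)) i) j    ≡⟨ cong (λ z → lookup z j) (lookup∘tabulate (λ i → row (R i) C (B i)) i) ⟩
  lookup (row (R i) C (B i)) j                              ≡⟨ lookup∘tabulate _ j ⟩
  (if R i ∧ C j then just (B i j) else nothing)             ∎
  where open ≡-Reasoning

volume-≤ : ∀ {L} K T (cs : List (Vec (Maybe Bool) L)) → (∀ {c} → c ∈ cs → weight c * K ≤ T) →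
  volume cs * K ≤ length cs * T
volume-≤ K T []       h = z≤n
volume-≤ K T (c ∷ cs) h = begin
  (weight c + volume cs) * K      ≡⟨ *-distribʳ-+ K (weight c) _ ⟩
  weight c * K + volume cs * K    ≤⟨ +-mono-≤ (h (here refl)) (volume-≤ K T cs (h ∘ there)) ⟩
  T + length cs * T               ∎
  where open ≤-Reasoning

-- Low-rank matrices as a union of subcubes

_·_ : ∀ {n r q} → (Fin n → Fin r → Bool) → (Fin r → Fin q → Bool) → Fin n → Fin q → Bool
(P · Q) i j = ⨁ λ l → P i l ∧ Q l j

Factors : ∀ {n q} → ℕ → (Fin n → Fin q → Bool) → Set
Factors {n} {q} r M = Σ (Fin n → Fin r → Bool) λ P → Σ (Fin r → Fin q → Bool) λ Q → ∀ i j → M i j ≡ (P · Q) i j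

bits : ∀ {L} → Fin (2 ^ L) → Fin L → Bool
bits u = Inverse.to 2↔Bool ∘ finToFun u

unbits : ∀ {L} → (Fin L → Bool) → Fin (2 ^ L)
unbits p = funToFin (Inverse.from 2↔Bool ∘ p)

bits-unbits : ∀ {L} (p : Fin L → Bool) i → bits (unbits p) i ≡ p i
bits-unbits p i = trans (cong (Inverse.to 2↔Bool) (finToFun-funToFin (Inverse.from 2↔Bool ∘ p) i))
                        (Inverse.strictlyInverseˡ 2↔Bool (p i))

-- A code describes R, C, P and Q; its constraint is the subcube of the matrices
-- that agree with P · Q on R × C.
module Union (n q r θ : ℕ) where

  codeLength : ℕ
  codeLength = n + (q + (n * r + r * q))

  module Decode (v : Fin codeLength → Bool) where
    R : Fin n → Bool
    R i = v (i ↑ˡ (q + (n * r + r * q)))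
    C : Fin q → Bool
    C j = v (n ↑ʳ (j ↑ˡ (n * r + r * q)))
    P : Fin n → Fin r → Bool
    P i l = v (n ↑ʳ (q ↑ʳ (combine i l ↑ˡ (r * q))))
    Q : Fin r → Fin q → Bool
    Q l j = v (n ↑ʳ (q ↑ʳ (n * r ↑ʳ combine l j)))

  encode : (Fin n → Bool) → (Fin q → Bool) → (Fin n → Fin r → Bool) → (Fin r → Fin q → Bool) → Fin codeLength → Bool
  encode R C P Q u = [ R , (λ u → [ C , (λ u → [ (λ u → uncurry P (remQuot r u)) , (λ u → uncurry Q (remQuot q u)) ]′
    (splitAt (n * r) u)) ]′ (splitAt q u)) ]′ (splitAt n u)

  module _ (R : Fin n → Bool) (C : Fin q → Bool) (P : Fin n → Fin r → Bool) (Q : Fin r → Fin q → Bool) where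
    private module E = Decode (encode R C P Q)

    decode-R : ∀ i → E.R i ≡ R i
    decode-R i rewrite splitAt-↑ˡ n i (q + (n * r + r * q)) = refl

    decode-C : ∀ j → E.C j ≡ C j
    decode-C j rewrite splitAt-↑ʳ n (q + (n * r + r * q)) (j ↑ˡ (n * r + r * q))
                     | splitAt-↑ˡ q j (n * r + r * q) = refl

    decode-P : ∀ i l → E.P i l ≡ P i l
    decode-P i l rewrite splitAt-↑ʳ n (q + (n * r + r * q)) (q ↑ʳ (combine i l ↑ˡ (r * q)))
                       | splitAt-↑ʳ q (n * r + r * q) (combine i l ↑ˡ (r * q))
                       | splitAt-↑ˡ (n * r) (combine i l) (r * q)
                       = cong (uncurry P) (remQuot-combine i l)

    decode-Q : ∀ l j → E.Q l j ≡ Q l j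
    decode-Q l j rewrite splitAt-↑ʳ n (q + (n * r + r * q)) (q ↑ʳ (n * r ↑ʳ combine l j))
                       | splitAt-↑ʳ q (n * r + r * q) (n * r ↑ʳ combine l j)
                       | splitAt-↑ʳ (n * r) (r * q) (combine l j)
                       = cong (uncurry Q) (remQuot-combine l j)

  Large : Fin (2 ^ codeLength) → Set
  Large u = θ ≤ cnt (Decode.R (bits u)) × θ ≤ cnt (Decode.C (bits u))

  large? : ∀ u → Dec (Large u)
  large? u = (θ ≤? _) ×-dec (θ ≤? _)

  constraint : Fin (2 ^ codeLength) → Vec (Maybe Bool) (n * q)
  constraint u = cube (Decode.R (bits u)) (Decode.C (bits u)) (Decode.P (bits u) · Decode.Q (bits u))

  constraints : List (Vec (Maybe Bool) (n * q))
  constraints = List.map constraint (filter large? (allFin _))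

  weight-constraint : ∀ {c} → c ∈ constraints → weight c * 2 ^ (θ * θ) ≤ 2 ^ (n * q)
  weight-constraint p with u , u∈ , refl ← ∈-map⁻ constraint p
    with _ , θ≤R , θ≤C ← ∈-filter⁻ large? {xs = allFin _} u∈ = begin
    weight (constraint u) * 2 ^ (θ * θ)              ≤⟨ *-monoʳ-≤ (weight (constraint u)) (^-monoʳ-≤ 2 (*-mono-≤ θ≤R θ≤C)) ⟩
    weight (constraint u) * 2 ^ (cnt D.R * cnt D.C)  ≡⟨ weight-cube D.R D.C (D.P · D.Q) ⟩
    2 ^ (n * q)                                      ∎
    where
    open ≤-Reasoning
    module D = Decode (bits u)

  length-constraints : length constraints ≤ 2 ^ codeLength
  length-constraints = begin
    length constraints                     ≡⟨ length-map constraint (filter large? (allFin _)) ⟩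
    length (filter large? (allFin _))      ≤⟨ length-filter large? (allFin _) ⟩
    length (allFin (2 ^ codeLength))       ≡⟨ length-tabulate id ⟩
    2 ^ codeLength                         ∎
    where open ≤-Reasoning

  -- Union bound, multiplied through by `2 ^ (θ * θ)`: at most `2 ^ codeLength` cubes, each filling
  -- at most a `2 ^ (θ * θ)`-th part of the whole cube.
  volume-constraints : codeLength < θ * θ → volume constraints < 2 ^ (n * q)
  volume-constraints lt = *-cancelʳ-< (2 ^ (θ * θ)) _ _ (begin-strict
    volume constraints * 2 ^ (θ * θ)     ≤⟨ volume-≤ (2 ^ (θ * θ)) (2 ^ (n * q)) constraints weight-constraint ⟩
    length constraints * 2 ^ (n * q)     ≤⟨ *-monoˡ-≤ (2 ^ (n * q)) length-constraints ⟩
    2 ^ codeLength * 2 ^ (n * q)         <⟨ *-monoˡ-< (2 ^ (n * q)) {{m^n≢0 2 (n * q)}} (^-monoʳ-< 2 (s≤s (s≤s z≤n)) lt) ⟩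
    2 ^ (θ * θ) * 2 ^ (n * q)            ≡⟨ *-comm (2 ^ (θ * θ)) _ ⟩
    2 ^ (n * q) * 2 ^ (θ * θ)            ∎)
    where open ≤-Reasoning

  -- Zeroing the entries outside `R × C` preserves the rank of the submatrix and keeps the index
  -- types. Over GF(2), the absence of a factorisation through `r` says that this rank exceeds `r`.
  Rigid : (Fin n → Fin q → Bool) → Set
  Rigid M = ∀ R C → θ ≤ cnt R → θ ≤ cnt C → ¬ Factors r (λ i j → (R i ∧ C j) ∧ M i j)

  rigid-matrix : codeLength < θ * θ → ∃ Rigid
  rigid-matrix lt with v , avoids ← uncovered (n * q) constraints (volume-constraints lt) =
    (λ i j → lookup v (combine i j)) , λ R C θ≤R θ≤C (P , Q , eq) →
    let code = encode R C P Q
        u = unbits code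
        module D = Decode (bits u)
        R≗ : D.R ≗ R
        R≗ i = trans (bits-unbits code _) (decode-R R C P Q i)
        C≗ : D.C ≗ C
        C≗ j = trans (bits-unbits code _) (decode-C R C P Q j)
        PQ≗ : ∀ i j → (D.P · D.Q) i j ≡ (P · Q) i j
        PQ≗ i j = sum-cong-≗ λ l → cong₂ _∧_ (trans (bits-unbits code _) (decode-P R C P Q i l))
                                             (trans (bits-unbits code _) (decode-Q R C P Q l j))
        matches : ∀ i j b → lookup (constraint u) (combine i j) ≡ just b → lookup v (combine i j) ≡ b
        -- The cube fixes entries on `R × C` only, and there the mask is transparent, so the
        -- factorisation determines the entry of `M` itself.
        matches i j b e = masked (R i ∧ C j) (eq i j) (begin
          (if R i ∧ C j then just ((P · Q) i j) else nothing)
            ≡⟨ cong₂ (λ m x → if m then just x else nothing) (cong₂ _∧_ (R≗ i) (C≗ j)) (PQ≗ i j) ⟨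
          (if D.R i ∧ D.C j then just ((D.P · D.Q) i j) else nothing)
            ≡⟨ lookup-cube D.R D.C (D.P · D.Q) i j ⟨
          lookup (constraint u) (combine i j)  ≡⟨ e ⟩
          just b ∎)
    in avoids (∈-map⁺ constraint (∈-filter⁺ large? (∈-allFin u)
         ( subst (θ ≤_) (sym (cnt-cong R≗)) θ≤R , subst (θ ≤_) (sym (cnt-cong C≗)) θ≤C)))
       λ k b e → subst (λ k → lookup v k ≡ b) (combine-remQuot {n} q k)
         (matches _ _ b (trans (cong (lookup (constraint u)) (combine-remQuot {n} q k)) e))
    where
    open ≡-Reasoning
    masked : ∀ m {x y b} → m ∧ x ≡ y → (if m then just y else nothing) ≡ just b → x ≡ b
    masked true x≡y refl = x≡y

-- Gaussian elimination over GF(2)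

dot : ∀ {q} → (Fin q → Bool) → (Fin q → Bool) → Bool
dot f z = ⨁ λ j → f j ∧ z j

⨁-zero : ∀ {q} {f : Fin q → Bool} → (∀ j → f j ≡ false) → ⨁ f ≡ false
⨁-zero {zero}  h = refl
⨁-zero {suc q} h rewrite h zero = ⨁-zero (h ∘ suc)

⨁-single : ∀ {q} (f : Fin q → Bool) c j₀ → (⨁ λ j → f j ∧ (c ∧ does (j₀ ≟ j))) ≡ c ∧ f j₀
⨁-single {suc q} f c zero
  rewrite ⨁-zero {f = λ j → f (suc j) ∧ (c ∧ false)} (λ j → trans (cong (f (suc j) ∧_) (∧-zeroʳ c)) (∧-zeroʳ _)) = lemma c (f zero)
  where
  lemma : ∀ c x → (x ∧ (c ∧ true)) xor false ≡ c ∧ x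
  lemma false false = refl
  lemma false true  = refl
  lemma true  false = refl
  lemma true  true  = refl
⨁-single {suc q} f c (suc j₀)
  rewrite ∧-zeroʳ c | ∧-zeroʳ (f zero) = ⨁-single (f ∘ suc) c j₀

dot-toggle : ∀ {q} (f z : Fin q → Bool) c j₀ →
  dot f (λ j → z j xor (c ∧ does (j₀ ≟ j))) ≡ dot f z xor (c ∧ f j₀)
dot-toggle f z c j₀ = begin
  dot f (λ j → z j xor (c ∧ does (j₀ ≟ j)))
    ≡⟨ sum-cong-≗ (λ j → CommutativeRing.distribˡ xor-∧-commutativeRing (f j) (z j) (c ∧ does (j₀ ≟ j))) ⟩
  (⨁ λ j → (f j ∧ z j) xor (f j ∧ (c ∧ does (j₀ ≟ j))))
    ≡⟨ ∑-distrib-+ (λ j → f j ∧ z j) _ ⟩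
  dot f z xor (⨁ λ j → f j ∧ (c ∧ does (j₀ ≟ j)))
    ≡⟨ cong (dot f z xor_) (⨁-single f c j₀) ⟩
  dot f z xor (c ∧ f j₀) ∎
  where open ≡-Reasoning

-- Subtracts the outer product of column `j₀` and row `i₀`, a matrix of rank at most one. When
-- `N i₀ j₀` is true, this clears row `i₀` and column `j₀`.
pivot : ∀ {n q} → Fin n → Fin q → (Fin n → Fin q → Bool) → Fin n → Fin q → Bool
pivot i₀ j₀ N i j = N i j xor (N i j₀ ∧ N i₀ j)

dot-pivot : ∀ {n q} i₀ j₀ (N : Fin n → Fin q → Bool) i z →
  dot (pivot i₀ j₀ N i) z ≡ dot (N i) z xor (N i j₀ ∧ dot (N i₀) z)
dot-pivot i₀ j₀ N i z = begin
  dot (pivot i₀ j₀ N i) z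
    ≡⟨ sum-cong-≗ (λ j → distrib (N i j) (N i j₀) (N i₀ j) (z j)) ⟩
  (⨁ λ j → (N i j ∧ z j) xor (N i j₀ ∧ (N i₀ j ∧ z j)))
    ≡⟨ ∑-distrib-+ (λ j → N i j ∧ z j) _ ⟩
  dot (N i) z xor (⨁ λ j → N i j₀ ∧ (N i₀ j ∧ z j))
    ≡⟨ cong (dot (N i) z xor_) (*-distribˡ-sum (N i j₀) (λ j → N i₀ j ∧ z j)) ⟨
  dot (N i) z xor (N i j₀ ∧ dot (N i₀) z) ∎
  where
  open ≡-Reasoning
  distrib : ∀ a b c d → (a xor (b ∧ c)) ∧ d ≡ (a ∧ d) xor (b ∧ (c ∧ d))
  distrib false false c     d = refl
  distrib false true  c     d = refl
  distrib true  false c     false = refl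
  distrib true  false c     true = refl
  distrib true  true  false false = refl
  distrib true  true  false true  = refl
  distrib true  true  true  false = refl
  distrib true  true  true  true  = refl

-- High rank in the form in which a fooling set consumes it: explicit preimages of `2 ^ r` distinct
-- vectors, without bases or dimensions.
ManyImages : ∀ {n q} → ℕ → (Fin n → Fin q → Bool) → Set
ManyImages {n} {q} r N = Σ (Fin (2 ^ r) → Fin q → Bool) λ Z →
  ∀ u v → (∀ i → dot (N i) (Z u) ≡ dot (N i) (Z v)) → u ≡ v

factors-pivot : ∀ {n q} r i₀ j₀ (N : Fin n → Fin q → Bool) →
  Factors r (pivot i₀ j₀ N) → Factors (suc r) N
factors-pivot r i₀ j₀ N (P , Q , eq) = P′ , Q′ , λ i j →
  trans (cancel (N i j) (N i j₀ ∧ N i₀ j)) (cong ((N i j₀ ∧ N i₀ j) xor_) (eq i j))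
  where
  P′ : Fin _ → Fin (suc r) → Bool
  P′ i zero    = N i j₀
  P′ i (suc l) = P i l
  Q′ : Fin (suc r) → Fin _ → Bool
  Q′ zero    = N i₀
  Q′ (suc l) = Q l
  cancel : ∀ x y → x ≡ y xor (x xor y)
  cancel false false = refl
  cancel false true  = refl
  cancel true  false = refl
  cancel true  true  = refl

-- The pivot step kills row i₀, so row i₀ of the image is still free to encode
-- one more bit, which is done by toggling entry j₀ of the preimage.
manyImages-pivot : ∀ {n q} r i₀ j₀ (N : Fin n → Fin q → Bool) → N i₀ j₀ ≡ true →
  ManyImages r (pivot i₀ j₀ N) → ManyImages (suc r) N
manyImages-pivot {n} {q} r i₀ j₀ N e (Z , inj) = Z′ , injective
  where
  bit : Fin (2 ^ suc r) → Bool
  bit u = Inverse.to 2↔Bool (proj₁ (remQuot {2} (2 ^ r) u))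
  rest : Fin (2 ^ suc r) → Fin (2 ^ r)
  rest u = proj₂ (remQuot {2} (2 ^ r) u)
  Z′ : Fin (2 ^ suc r) → Fin q → Bool
  Z′ u j = Z (rest u) j xor ((bit u xor dot (N i₀) (Z (rest u))) ∧ does (j₀ ≟ j))

  image : ∀ u i → dot (N i) (Z′ u) ≡ dot (pivot i₀ j₀ N i) (Z (rest u)) xor (bit u ∧ N i j₀)
  image u i = begin
    dot (N i) (Z′ u)
      ≡⟨ dot-toggle (N i) (Z (rest u)) _ j₀ ⟩
    dot (N i) (Z (rest u)) xor ((bit u xor dot (N i₀) (Z (rest u))) ∧ N i j₀)
      ≡⟨ regroup (dot (N i) (Z (rest u))) (bit u) (dot (N i₀) (Z (rest u))) (N i j₀) ⟩
    (dot (N i) (Z (rest u)) xor (N i j₀ ∧ dot (N i₀) (Z (rest u)))) xor (bit u ∧ N i j₀)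
      ≡⟨ cong (_xor (bit u ∧ N i j₀)) (dot-pivot i₀ j₀ N i (Z (rest u))) ⟨
    dot (pivot i₀ j₀ N i) (Z (rest u)) xor (bit u ∧ N i j₀) ∎
    where
    open ≡-Reasoning
    regroup : ∀ a b c d → a xor ((b xor c) ∧ d) ≡ (a xor (d ∧ c)) xor (b ∧ d)
    regroup false false false false = refl
    regroup false false false true  = refl
    regroup false false true  false = refl
    regroup false false true  true  = refl
    regroup false true  false false = refl
    regroup false true  false true  = refl
    regroup false true  true  false = refl
    regroup false true  true  true  = refl
    regroup true  false false false = refl
    regroup true  false false true  = refl
    regroup true  false true  false = refl
    regroup true  false true  true  = refl
    regroup true  true  false false = refl
    regroup true  true  false true  = refl
    regroup true  true  true  false = refl
    regroup true  true  true  true  = refl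

  -- This fixes the toggle coefficient in `Z′`: as `N i₀ j₀` is true, toggling entry `j₀` changes
  -- the product with row `i₀`, so adding `bit u xor dot (N i₀) (Z (rest u))` replaces that product
  -- by `bit u`.
  image-pivot-row : ∀ u → dot (N i₀) (Z′ u) ≡ bit u
  image-pivot-row u rewrite image u i₀ | dot-pivot i₀ j₀ N i₀ (Z (rest u)) | e = collapse (dot (N i₀) (Z (rest u))) (bit u)
    where
    collapse : ∀ d b → (d xor d) xor (b ∧ true) ≡ b
    collapse false b = ∧-identityʳ b
    collapse true  b = ∧-identityʳ b

  xor-cancelʳ : ∀ x y b → x xor b ≡ y xor b → x ≡ y
  xor-cancelʳ false false b     h = refl
  xor-cancelʳ true  true  b     h = refl
  xor-cancelʳ false true  false ()
  xor-cancelʳ false true  true  ()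
  xor-cancelʳ true  false false ()
  xor-cancelʳ true  false true  ()

  injective : ∀ u v → (∀ i → dot (N i) (Z′ u) ≡ dot (N i) (Z′ v)) → u ≡ v
  injective u v h = begin
    u                                             ≡⟨ combine-remQuot {2} (2 ^ r) u ⟨
    combine (proj₁ (remQuot {2} (2 ^ r) u)) (rest u)  ≡⟨ cong₂ combine first≡ rest≡ ⟩
    combine (proj₁ (remQuot {2} (2 ^ r) v)) (rest v)  ≡⟨ combine-remQuot {2} (2 ^ r) v ⟩
    v                                             ∎
    where
    open ≡-Reasoning
    bit≡ : bit u ≡ bit v
    bit≡ = trans (sym (image-pivot-row u)) (trans (h i₀) (image-pivot-row v))
    first≡ : proj₁ (remQuot {2} (2 ^ r) u) ≡ proj₁ (remQuot {2} (2 ^ r) v)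
    first≡ = trans (sym (Inverse.strictlyInverseʳ 2↔Bool _))
               (trans (cong (Inverse.from 2↔Bool) bit≡) (Inverse.strictlyInverseʳ 2↔Bool _))
    rest≡ : rest u ≡ rest v
    rest≡ = inj (rest u) (rest v) λ i → xor-cancelʳ _ _ (bit v ∧ N i j₀)
      (trans (cong (λ b → dot (pivot i₀ j₀ N i) (Z (rest u)) xor (b ∧ N i j₀)) (sym bit≡))
        (trans (sym (image u i)) (trans (h i) (image v i))))

-- Up to `r` elimination rounds. If the matrix vanishes before they are used up, the outer products
-- removed so far factor it, padded with zeros to length `r`; otherwise each round has contributed
-- one bit to the images.
factors-or-manyImages : ∀ {n q} r (N : Fin n → Fin q → Bool) → Factors r N ⊎ ManyImages r N
factors-or-manyImages zero    N = inj₂ ((λ _ _ → false) , λ { zero zero _ → refl })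
factors-or-manyImages (suc r) N with any? (λ i → any? (λ j → N i j Bool.≟ true))
... | no none = inj₁ ((λ _ _ → false) , (λ _ _ → false) , λ i j →
  trans (¬-not (λ e → none (i , j , e))) (sym (⨁-zero {suc r} {λ _ → false} λ _ → refl)))
... | yes (i₀ , j₀ , e) with factors-or-manyImages r (pivot i₀ j₀ N)
...   | inj₁ f = inj₁ (factors-pivot r i₀ j₀ N f)
...   | inj₂ m = inj₂ (manyImages-pivot r i₀ j₀ N e m)

-- Structured DNNFs and rectangle covers

Assignment : ℕ → Set
Assignment m = Fin m → Bool

∨-true : ∀ {x y} → x ∨ y ≡ true → x ≡ true ⊎ y ≡ true
∨-true {true}  e = inj₁ refl
∨-true {false} e = inj₂ e

∧-true : ∀ {x y} → x ∧ y ≡ true → x ≡ true × y ≡ true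
∧-true {true} {true} e = refl , refl

any-witness : ∀ {A : Set} (p : A → Bool) xs → any p xs ≡ true → ∃ λ x → x ∈ xs × p x ≡ true
any-witness p (x ∷ xs) e with ∨-true {p x} e
... | inj₁ px = x , here refl , px
... | inj₂ e′ with y , y∈ , py ← any-witness p xs e′ = y , there y∈ , py

any-true : ∀ {A : Set} (p : A → Bool) {x xs} → x ∈ xs → p x ≡ true → any p xs ≡ true
any-true p (here refl)        px rewrite px = refl
any-true p (there {x = y} x∈) px rewrite any-true p x∈ px = ∨-zeroʳ (p y)

any-map : ∀ {A B : Set} (p : B → Bool) (f : A → B) xs → any p (List.map f xs) ≡ any (p ∘ f) xs
any-map p f []       = refl
any-map p f (x ∷ xs) = cong (p (f x) ∨_) (any-map p f xs)

any-cong : ∀ {A : Set} {p p′ : A → Bool} → p ≗ p′ → ∀ xs → any p xs ≡ any p′ xs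
any-cong eq []       = refl
any-cong eq (x ∷ xs) = cong₂ _∨_ (eq x) (any-cong eq xs)

module _ {m} (C : Circuit m) where

  open Evaluation C

  andL-cong : ∀ {A : Set} (xs : List A) {r r′ : ∀ {x} → x ∈ xs → Bool} →
    (∀ {x} (p : x ∈ xs) → r p ≡ r′ p) → andL xs r ≡ andL xs r′
  andL-cong []       h = refl
  andL-cong (x ∷ xs) h = cong₂ _∧_ (h (here refl)) (andL-cong xs (h ∘ there))

  orL-cong : ∀ {A : Set} (xs : List A) {r r′ : ∀ {x} → x ∈ xs → Bool} →
    (∀ {x} (p : x ∈ xs) → r p ≡ r′ p) → orL xs r ≡ orL xs r′
  orL-cong []       h = refl
  orL-cong (x ∷ xs) h = cong₂ _∨_ (h (here refl)) (orL-cong xs (h ∘ there))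

  evalGate-cong : ∀ a g {r r′ : ∀ {v} → v ∈ inputsOf g → Bool} →
    (∀ {v} (p : v ∈ inputsOf g) → r p ≡ r′ p) → evalGate a g r ≡ evalGate a g r′
  evalGate-cong a (input _ _)   h = refl
  evalGate-cong a (and-gate vs) h = andL-cong vs h
  evalGate-cong a (or-gate vs)  h = orL-cong vs h

  evalAcc-irrelevant : ∀ a {u} (p q : Acc _<ᶠ_ u) → evalAcc a u p ≡ evalAcc a u q
  evalAcc-irrelevant a {u} (acc rs) (acc rs′) =
    evalGate-cong a (gate C u) λ {v} p → evalAcc-irrelevant a (rs (acyclic C u v p)) (rs′ (acyclic C u v p))

  evalAcc-unfold : ∀ a {u} (p : Acc _<ᶠ_ u) →
    evalAcc a u p ≡ evalGate a (gate C u) (λ {v} _ → valueAt C a v)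
  evalAcc-unfold a {u} (acc rs) =
    evalGate-cong a (gate C u) λ {v} p → evalAcc-irrelevant a (rs (acyclic C u v p)) (<-wellFounded v)

  valueAt-unfold : ∀ a u → valueAt C a u ≡ evalGate a (gate C u) (λ {v} _ → valueAt C a v)
  valueAt-unfold a u = evalAcc-unfold a (<-wellFounded u)

  andL-all : ∀ {A : Set} (p : A → Bool) xs → andL xs (λ {x} _ → p x) ≡ all p xs
  andL-all p []       = refl
  andL-all p (x ∷ xs) = cong (p x ∧_) (andL-all p xs)

  orL-any : ∀ {A : Set} (p : A → Bool) xs → orL xs (λ {x} _ → p x) ≡ any p xs
  orL-any p []       = refl
  orL-any p (x ∷ xs) = cong (p x ∨_) (orL-any p xs)

  value-input : ∀ a {u x b} → gate C u ≡ input x b → valueAt C a u ≡ (if b then a x else not (a x))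
  value-input a {u} e rewrite valueAt-unfold a u | e = refl

  value-and : ∀ a {u vs} → gate C u ≡ and-gate vs → valueAt C a u ≡ all (valueAt C a) vs
  value-and a {u} {vs} e rewrite valueAt-unfold a u | e = andL-all (valueAt C a) vs

  value-or : ∀ a {u vs} → gate C u ≡ or-gate vs → valueAt C a u ≡ any (valueAt C a) vs
  value-or a {u} {vs} e rewrite valueAt-unfold a u | e = orL-any (valueAt C a) vs

  module Scope (scope : Fin (size C) → Fin m → Bool)
    (scope-input : ∀ {u x b} → gate C u ≡ input x b → scope u x ≡ true)
    (scope-wire : ∀ {u v x} → v ∈ inputsOf (gate C u) → scope v x ≡ true → scope u x ≡ true) where

    varIn-scope : ∀ {u x} → VarIn C u x → scope u x ≡ true
    varIn-scope (w , reach-refl , b , e)      = scope-input e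
    varIn-scope (w , reach-step p rs , b , e) = scope-wire p (varIn-scope (w , rs , b , e))

    value-local : ∀ {a a′} u → (∀ x → scope u x ≡ true → a x ≡ a′ x) → valueAt C a u ≡ valueAt C a′ u
    value-local {a} {a′} u = go u (<-wellFounded u)
      where
      go : ∀ u → Acc _<ᶠ_ u → (∀ x → scope u x ≡ true → a x ≡ a′ x) → valueAt C a u ≡ valueAt C a′ u
      go u (acc rs) h = begin
        valueAt C a u                                              ≡⟨ valueAt-unfold a u ⟩
        evalGate a (gate C u) (λ {v} _ → valueAt C a v)            ≡⟨ evalGate-cong a (gate C u) (λ {v} p → go v (rs (acyclic C u v p)) λ x sx → h x (scope-wire p sx)) ⟩
        evalGate a (gate C u) (λ {v} _ → valueAt C a′ v)           ≡⟨ same (gate C u) (λ x b e → h x (scope-input e)) ⟩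
        evalGate a′ (gate C u) (λ {v} _ → valueAt C a′ v)          ≡⟨ valueAt-unfold a′ u ⟨
        valueAt C a′ u                                             ∎
        where
        open ≡-Reasoning
        same : ∀ g → (∀ x b → g ≡ input x b → a x ≡ a′ x) → {r : ∀ {v} → v ∈ inputsOf g → Bool} →
          evalGate a g r ≡ evalGate a′ g r
        same (input x b)  h′ rewrite h′ x b refl = refl
        same (and-gate _) h′ = refl
        same (or-gate _)  h′ = refl

-- Vtrees and the balanced node

occurs : ∀ {m} → VTree m → Fin m → Bool
occurs (leaf y)   x = does (y ≟ x)
occurs (node l r) x = occurs l x ∨ occurs r x

occurs-leaf : ∀ {m} (x : Fin m) → occurs (leaf x) x ≡ true
occurs-leaf x = dec-true (x ≟ x) refl

occurs-leaf⁻ : ∀ {m} {x y : Fin m} → occurs (leaf y) x ≡ true → y ≡ x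
occurs-leaf⁻ {x = x} {y} e with y ≟ x
... | yes y≡x = y≡x

child-occurs : ∀ {m} {T : VTree m} {c p : Node T} {x} → ChildOf c p →
  occurs (subtree c) x ≡ true → occurs (subtree p) x ≡ true
child-occurs c-left         e rewrite e = refl
child-occurs {x = x} (c-right {l}) e rewrite e = ∨-zeroʳ (occurs l x)
child-occurs (in-left ch)   e = child-occurs ch e
child-occurs (in-right ch)  e = child-occurs ch e

UniqueLeaves : ∀ {m} → VTree m → Set
UniqueLeaves T = ∀ (p q : Node T) x → subtree p ≡ leaf x → subtree q ≡ leaf x → p ≡ q

occurs-node : ∀ {m} (T : VTree m) {x} → occurs T x ≡ true → ∃ λ (q : Node T) → subtree q ≡ leaf x
occurs-node (leaf y)   e = root , cong leaf (occurs-leaf⁻ e)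
occurs-node (node l r) {x} e with ∨-true {occurs l x} e
... | inj₁ e′ = let q , eq = occurs-node l e′ in left q , eq
... | inj₂ e′ = let q , eq = occurs-node r e′ in right q , eq

-- A variable under both children would label a leaf in the left and a leaf in the right subtree.
siblings-disjoint : ∀ {m} {T : VTree m} {c c′ p : Node T} → UniqueLeaves T → ChildOf c p → ChildOf c′ p → c ≢ c′ →
  ∀ {x} → occurs (subtree c) x ≡ true → occurs (subtree c′) x ≡ true → ⊥
siblings-disjoint un c-left  c-left  ne e e′ = ne refl
siblings-disjoint un c-right c-right ne e e′ = ne refl
siblings-disjoint un (c-left {l} {r}) c-right ne {x} e e′
  with q , eq ← occurs-node l e | q′ , eq′ ← occurs-node r e′ with () ← un (left q) (right q′) x eq eq′
siblings-disjoint un (c-right {l} {r}) c-left ne {x} e e′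
  with q , eq ← occurs-node r e | q′ , eq′ ← occurs-node l e′ with () ← un (right q) (left q′) x eq eq′
siblings-disjoint un (in-left ch)  (in-left ch′)  ne =
  siblings-disjoint (λ p q x e e′ → left-inj (un (left p) (left q) x e e′)) ch ch′ (ne ∘ cong left)
siblings-disjoint un (in-right ch) (in-right ch′) ne =
  siblings-disjoint (λ p q x e e′ → right-inj (un (right p) (right q) x e e′)) ch ch′ (ne ∘ cong right)

two-children : ∀ {m} {T : VTree m} {c c₁ c₂ p : Node T} → ChildOf c p → ChildOf c₁ p → ChildOf c₂ p → c₁ ≢ c₂ →
  c ≡ c₁ ⊎ c ≡ c₂
two-children c-left  c-left  _       ne = inj₁ refl
two-children c-left  c-right c-left  ne = inj₂ refl
two-children c-left  c-right c-right ne = contradiction refl ne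
two-children c-right c-right _       ne = inj₁ refl
two-children c-right c-left  c-right ne = inj₂ refl
two-children c-right c-left  c-left  ne = contradiction refl ne
two-children (in-left ch)  (in-left ch₁)  (in-left ch₂)  ne =
  [ inj₁ ∘ cong left , inj₂ ∘ cong left ]′ (two-children ch ch₁ ch₂ (ne ∘ cong left))
two-children (in-right ch) (in-right ch₁) (in-right ch₂) ne =
  [ inj₁ ∘ cong right , inj₂ ∘ cong right ]′ (two-children ch ch₁ ch₂ (ne ∘ cong right))

child-of-nonleaf : ∀ {m} {T : VTree m} {c p : Node T} {x} → ChildOf c p → subtree p ≢ leaf x
child-of-nonleaf (in-left ch)  e = child-of-nonleaf ch e
child-of-nonleaf (in-right ch) e = child-of-nonleaf ch e

children : ∀ {m} {T : VTree m} (p : Node T) {l r} → subtree p ≡ node l r →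
  ∃ λ c → ∃ λ c′ → (ChildOf c p × subtree c ≡ l) × (ChildOf c′ p × subtree c′ ≡ r)
children {T = node l r} root refl = left root , right root , (c-left , refl) , (c-right , refl)
children (left p)  e with c , c′ , (ch , eq) , (ch′ , eq′) ← children p e =
  left c , left c′ , (in-left ch , eq) , (in-left ch′ , eq′)
children (right p) e with c , c′ , (ch , eq) , (ch′ , eq′) ← children p e =
  right c , right c′ , (in-right ch , eq) , (in-right ch′ , eq′)

data Below {m} {T : VTree m} (t : Node T) : Node T → Set where
  here  : Below t t
  below : ∀ {c p} → ChildOf c p → Below t c → Below t p

below-occurs : ∀ {m} {T : VTree m} {t p : Node T} {x} → Below t p → occurs (subtree t) x ≡ true → occurs (subtree p) x ≡ true
below-occurs here         e = e
below-occurs (below ch b) e = child-occurs ch (below-occurs b e)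

cnt-∨ : ∀ {n} (p q : Fin n → Bool) → cnt (λ i → p i ∨ q i) ≤ cnt p + cnt q
cnt-∨ {zero}  p q = z≤n
cnt-∨ {suc n} p q with p zero | q zero | cnt-∨ (p ∘ suc) (q ∘ suc)
... | true  | true  | ih = s≤s (≤-trans ih (+-monoʳ-≤ (cnt (p ∘ suc)) (n≤1+n _)))
... | true  | false | ih = s≤s ih
... | false | true  | ih = ≤-trans (s≤s ih) (≤-reflexive (sym (+-suc (cnt (p ∘ suc)) _)))
... | false | false | ih = ih

cnt-zero : ∀ {n} {p : Fin n → Bool} → (∀ i → p i ≡ false) → cnt p ≡ 0
cnt-zero {zero}  h = refl
cnt-zero {suc n} h rewrite h zero = cnt-zero (h ∘ suc)

cnt-≤1 : ∀ {n} {p : Fin n → Bool} → (∀ i j → p i ≡ true → p j ≡ true → i ≡ j) → cnt p ≤ 1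
cnt-≤1 {zero}      h = z≤n
cnt-≤1 {suc n} {p} h with p zero in e
... | true  = s≤s (≤-reflexive (cnt-zero λ i → ¬-not λ e′ → case (h zero (suc i) e e′)))
  where
  case : ∀ {i : Fin n} → zero ≢ Fin.suc i
  case ()
... | false = cnt-≤1 λ i j ei ej → suc-injectiveᶠ (h (suc i) (suc j) ei ej)

cnt-full : ∀ {n} {p : Fin n → Bool} → (∀ i → p i ≡ true) → cnt p ≡ n
cnt-full {zero}  h = refl
cnt-full {suc n} h rewrite h zero = cong suc (cnt-full (h ∘ suc))

cnt-not : ∀ {n} (p : Fin n → Bool) → cnt p + cnt (not ∘ p) ≡ n
cnt-not {zero}  p = refl
cnt-not {suc n} p with p zero
... | true  = cong suc (cnt-not (p ∘ suc))
... | false = trans (+-suc (cnt (p ∘ suc)) _) (cong suc (cnt-not (p ∘ suc)))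

Essential : ∀ {m} → (Assignment m → Bool) → Fin m → Set
Essential f x = ∃ λ a → ∃ λ a′ → (∀ y → y ≢ x → a y ≡ a′ y) × f a ≢ f a′

module Descent {m n} {T : VTree m} (x : Fin n → Fin m) (x-injective : ∀ i j → x i ≡ x j → i ≡ j) where

  weightAt : Node T → ℕ
  weightAt t = cnt (λ i → occurs (subtree t) (x i))

  weightAt-leaf : ∀ t {y} → subtree t ≡ leaf y → weightAt t ≤ 1
  weightAt-leaf t {y} e rewrite e = cnt-≤1 λ i j ei ej →
    x-injective i j (trans (sym (occurs-leaf⁻ {y = y} ei)) (occurs-leaf⁻ {y = y} ej))

  -- As long as a node holds more than `2 * θ` of the `x`, one child holds more than `θ`; the walk
  -- stops at the first such child with at most `2 * θ`. The first step `c` is recorded because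
  -- `through` needs a node strictly below the start.
  descend : ∀ θ → 1 ≤ θ → ∀ s (p : Node T) → subtree p ≡ s → 2 * θ < weightAt p →
    ∃ λ t → ∃ λ c → ChildOf c p × Below t c × θ < weightAt t × weightAt t ≤ 2 * θ
  descend θ 1≤θ (leaf y)   p e lt = contradiction (begin-strict
    1            ≤⟨ 1≤θ ⟩
    θ            ≤⟨ m≤m+n θ _ ⟩
    2 * θ        <⟨ lt ⟩
    weightAt p   ≤⟨ weightAt-leaf p e ⟩
    1            ∎) (<-irrefl refl)
    where open ≤-Reasoning
  descend θ 1≤θ (node l r) p e lt with c , c′ , (ch , eq) , (ch′ , eq′) ← children p e =
    [ into l ch eq , into r ch′ eq′ ]′ heavy
    where
    into : ∀ s {c} → ChildOf c p → subtree c ≡ s → θ < weightAt c →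
      ∃ λ t → ∃ λ c → ChildOf c p × Below t c × θ < weightAt t × weightAt t ≤ 2 * θ
    into s {c} ch eq θ< with weightAt c ≤? 2 * θ
    ... | yes ≤2θ = c , c , ch , here , θ< , ≤2θ
    ... | no  ≰2θ with t , c′ , ch′ , b , bounds ← descend θ 1≤θ s c eq (≰⇒> ≰2θ) =
      t , c , ch , below ch′ b , bounds
    heavy : θ < weightAt c ⊎ θ < weightAt c′
    heavy with θ <? weightAt c | θ <? weightAt c′
    ... | yes θ<c | _        = inj₁ θ<c
    ... | no  _   | yes θ<c′ = inj₂ θ<c′
    ... | no  θ≮c | no  θ≮c′ = contradiction (begin-strict
      2 * θ                                            <⟨ lt ⟩
      weightAt p                                       ≡⟨ cnt-cong (λ i → trans (cong (λ s → occurs s (x i)) e)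
                                                            (sym (cong₂ (λ s s′ → occurs s (x i) ∨ occurs s′ (x i)) eq eq′))) ⟩
      cnt (λ i → occurs (subtree c) (x i) ∨ occurs (subtree c′) (x i)) ≤⟨ cnt-∨ (λ i → occurs (subtree c) (x i)) (λ i → occurs (subtree c′) (x i)) ⟩
      weightAt c + weightAt c′                         ≤⟨ +-mono-≤ (≮⇒≥ θ≮c) (≤-trans (≮⇒≥ θ≮c′) (≤-reflexive (sym (+-identityʳ θ)))) ⟩
      2 * θ                                            ∎) (<-irrefl refl)
      where open ≤-Reasoning

isAnd-inv : ∀ {m s} {g : Gate m s} → isAnd g ≡ true → ∃ λ vs → g ≡ and-gate vs
isAnd-inv {g = and-gate vs} _ = vs , refl

isOr-inv : ∀ {m s} {g : Gate m s} → isOr g ≡ true → ∃ λ vs → g ≡ or-gate vs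
isOr-inv {g = or-gate vs} _ = vs , refl

isInput-inv : ∀ {m s} {g : Gate m s} → isInput g ≡ true → ∃ λ x → ∃ λ b → g ≡ input x b
isInput-inv {g = input x b} _ = x , b , refl

gate-kind : ∀ {m s} (g : Gate m s) → isAnd g ≡ true ⊎ isOr g ≡ true ⊎ isInput g ≡ true
gate-kind (input _ _)  = inj₂ (inj₂ refl)
gate-kind (and-gate _) = inj₁ refl
gate-kind (or-gate _)  = inj₂ (inj₁ refl)

-- Stated for a bare circuit with a labelling, because `Automaton` uses it to derive decomposability
-- before a `CSDNNF` exists; `Cut` instantiates it for an arbitrary `CSDNNF`.
module Placed {m} {T : VTree m} (C : Circuit m) (pl : Fin (size C) → Node T)
  (input-leaf : ∀ {u x b} → gate C u ≡ input x b → subtree (pl u) ≡ leaf x)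
  (wires : ∀ v u → u ∈ inputsOf (gate C v) →
    (isAnd (gate C v) ≡ true × (isOr (gate C u) ≡ true ⊎ isInput (gate C u) ≡ true) × ChildOf (pl u) (pl v))
    ⊎ (isOr (gate C v) ≡ true × isAnd (gate C u) ≡ true × pl u ≡ pl v)) where

  scopeAt : Fin (size C) → Fin m → Bool
  scopeAt u = occurs (subtree (pl u))

  scopeAt-input : ∀ {u x b} → gate C u ≡ input x b → scopeAt u x ≡ true
  scopeAt-input {u} {x} e = trans (cong (λ s → occurs s x) (input-leaf e)) (occurs-leaf x)

  scopeAt-wire : ∀ {u v x} → v ∈ inputsOf (gate C u) → scopeAt v x ≡ true → scopeAt u x ≡ true
  scopeAt-wire {u} {v} {x} p e with wires u v p
  ... | inj₁ (_ , _ , ch) = child-occurs ch e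
  ... | inj₂ (_ , _ , eq) = trans (cong (λ t → occurs (subtree t) x) (sym eq)) e

  open Scope C scopeAt (λ {u} {x} {b} → scopeAt-input {u} {x} {b}) (λ {u} {v} {x} → scopeAt-wire {u} {v} {x}) public

  and-wire : ∀ {u vs v} → gate C u ≡ and-gate vs → v ∈ vs →
    (isOr (gate C v) ≡ true ⊎ isInput (gate C v) ≡ true) × ChildOf (pl v) (pl u)
  and-wire {u} {v = v} eq v∈ with wires u v (subst (λ g → v ∈ inputsOf g) (sym eq) v∈)
  ... | inj₁ (_ , kind , ch) = kind , ch
  ... | inj₂ (isO , _) with () ← trans (sym isO) (cong isOr eq)

  or-wire : ∀ {u vs v} → gate C u ≡ or-gate vs → v ∈ vs → isAnd (gate C v) ≡ true × pl v ≡ pl u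
  or-wire {u} {v = v} eq v∈ with wires u v (subst (λ g → v ∈ inputsOf g) (sym eq) v∈)
  ... | inj₁ (isA , _) with () ← trans (sym isA) (cong isAnd eq)
  ... | inj₂ (_ , isA , at) = isA , at

module Cut {m} {T : VTree m} (E : CSDNNF m T) where

  private
    C = circuit E
    module S = IsCompleteStructured (structured E)

  unique : UniqueLeaves T
  unique = proj₁ S.vtree-for

  input-leaf : ∀ {u x b} → gate C u ≡ input x b → subtree (place E u) ≡ leaf x
  input-leaf {u} {x} {b} e with y , eq ← S.inputs-at-leaves u x b e
    with b′ , e′ ← S.leaf-gates u y eq with refl ← trans (sym e) e′ = eq

  open Placed C (place E) (λ {u} {x} {b} → input-leaf {u} {x} {b}) S.wires public

  module _ {t : Node T} (inner : ∀ {x} → subtree t ≢ leaf x) where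

    -- A rectangle through g: the values outside t make u depend on t only through g.
    Through : Assignment m → Fin (size C) → Set
    Through a u = ∃ λ g → isOr (gate C g) ≡ true × place E g ≡ t × valueAt C a g ≡ true ×
      (∀ a′ → (∀ x → occurs (subtree t) x ≡ false → a′ x ≡ a x) → valueAt C a′ g ≡ true → valueAt C a′ u ≡ true)

    -- Follows true gates from `u` down to `t`. The two inputs of an and-gate sit at the two
    -- different children of its node, so one of them lies on the way to `t`. The other one sees no
    -- variable of `t`, so it keeps its value when only the assignment on `t` changes.
    through-and : ∀ {c a u} → Below t c → isAnd (gate C u) ≡ true → ChildOf c (place E u) →
      valueAt C a u ≡ true → Through a u
    through-or : ∀ {p a v} → Below t p → place E v ≡ p → isOr (gate C v) ≡ true ⊎ isInput (gate C v) ≡ true →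
      valueAt C a v ≡ true → Through a v

    through-and {c} {a} {u} b isA ch val
      with vs , eq ← isAnd-inv isA
      with v₁ , v₂ , refl , ne ← S.and-fanin u vs eq =
      [ (λ c≡ → via v₁ v₂ c≡ kind₁ ch₁ ch₂ ne val₁ val₂ (λ a′ e₁ e₂ → both a′ e₁ e₂))
      , (λ c≡ → via v₂ v₁ c≡ kind₂ ch₂ ch₁ (ne ∘ sym) val₂ val₁ (λ a′ e₂ e₁ → both a′ e₁ e₂))
      ]′ (two-children ch ch₁ ch₂ ne)
      where
      kind₁ = proj₁ (and-wire eq (here refl))
      ch₁   = proj₂ (and-wire eq (here refl))
      kind₂ = proj₁ (and-wire eq (there (here refl)))
      ch₂   = proj₂ (and-wire eq (there (here refl)))
      vals : valueAt C a v₁ ≡ true × valueAt C a v₂ ∧ true ≡ true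
      vals = ∧-true (trans (sym (value-and C a eq)) val)
      val₁ = proj₁ vals
      val₂ = proj₁ (∧-true (proj₂ vals))
      both : ∀ a′ → valueAt C a′ v₁ ≡ true → valueAt C a′ v₂ ≡ true → valueAt C a′ u ≡ true
      both a′ e₁ e₂ = trans (value-and C a′ eq) (cong₂ (λ x y → x ∧ (y ∧ true)) e₁ e₂)
      via : ∀ v v′ → c ≡ place E v → isOr (gate C v) ≡ true ⊎ isInput (gate C v) ≡ true →
        ChildOf (place E v) (place E u) → ChildOf (place E v′) (place E u) → place E v ≢ place E v′ →
        valueAt C a v ≡ true → valueAt C a v′ ≡ true →
        (∀ a′ → valueAt C a′ v ≡ true → valueAt C a′ v′ ≡ true → valueAt C a′ u ≡ true) → Through a u
      via v v′ refl kind chv chv′ nev valv valv′ join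
        with g , isO , at , valg , lift ← through-or b refl kind valv =
        g , isO , at , valg , λ a′ agree valg′ → join a′ (lift a′ agree valg′)
          (trans (value-local v′ λ x sx → agree x (¬-not λ sx′ →
            siblings-disjoint unique chv chv′ nev (below-occurs b sx′) sx)) valv′)

    through-or {v = v} here at (inj₁ isO) val = v , isO , at , val , λ _ _ e → e
    through-or here at (inj₂ isI) val with _ , _ , eq ← isInput-inv isI =
      contradiction (trans (cong subtree (sym at)) (input-leaf eq)) inner
    through-or (below ch b) refl (inj₂ isI) val with _ , _ , eq ← isInput-inv isI =
      contradiction (input-leaf eq) (child-of-nonleaf ch)
    through-or {a = a} {v} (below ch b) refl (inj₁ isO) val
      with vs , eq ← isOr-inv isO
      with w , w∈ , valw ← any-witness (valueAt C a) vs (trans (sym (value-or C a eq)) val)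
      with isA , at ← or-wire eq w∈
      with g , isO , at′ , valg , lift ← through-and {u = w} b isA (subst (ChildOf _) (sym at) ch) valw =
      g , isO , at′ , valg , λ a′ agree valg′ →
        trans (value-or C a′ eq) (any-true (valueAt C a′) w∈ (lift a′ agree valg′))

    -- The node `t` must lie strictly below `u`: an and-gate placed at `t` itself need not feed from
    -- any or-gate at `t`.
    through : ∀ {c a u} → ChildOf c (place E u) → Below t c → valueAt C a u ≡ true → Through a u
    through {u = u} ch b val with gate-kind (gate C u)
    ... | inj₁ isA  = through-and b isA ch val
    ... | inj₂ kind = through-or (below ch b) refl kind val

  orGatesAt : Node T → List (Fin (size C))
  orGatesAt t = filterᵇ (λ u → isOr (gate C u) ∧ ⌊ place E u ≟N t ⌋) (allFin (size C))

  ∈-orGatesAt⁺ : ∀ {t g} → isOr (gate C g) ≡ true → place E g ≡ t → g ∈ orGatesAt t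
  ∈-orGatesAt⁺ {t} {g} isO at = ∈-filter⁺ (λ u → T? _) (∈-allFin g)
    (Equivalence.from T-∧ (Equivalence.from T-≡ isO , fromWitness at))

  ∈-orGatesAt⁻ : ∀ {t g} → g ∈ orGatesAt t → isOr (gate C g) ≡ true × place E g ≡ t
  ∈-orGatesAt⁻ {t} {g} g∈
    with t₁ , t₂ ← Equivalence.to (T-∧ {isOr (gate C g)})
      (proj₂ (∈-filter⁻ (λ u → T? (isOr (gate C u) ∧ ⌊ place E u ≟N t ⌋)) {xs = allFin (size C)} g∈)) =
    Equivalence.to T-≡ t₁ , toWitness t₂

-- Rectangle `g` has `side g` as its factor on `A`. The factor outside `A` stays implicit: `covers`
-- says that the outside part of `a` can be completed by every inside part in `side g`.
record Cover {m} (A : Fin m → Bool) (f : Assignment m → Bool) (W : ℕ) : Set where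
  field
    side   : Fin W → Assignment m → Bool
    local  : ∀ g {a a′} → (∀ x → A x ≡ true → a x ≡ a′ x) → side g a ≡ side g a′
    covers : ∀ a → f a ≡ true → ∃ λ g → side g a ≡ true ×
      (∀ a′ → (∀ x → A x ≡ false → a′ x ≡ a x) → side g a′ ≡ true → f a′ ≡ true)

module Balance {m n} {T : VTree m} (E : CSDNNF m T) {f} (represents : Represents E f)
  (x : Fin n → Fin m) (x-injective : ∀ i j → x i ≡ x j → i ≡ j) (essential : ∀ i → Essential f (x i)) where

  open Cut E
  open Descent {T = T} x x-injective
  private
    C = circuit E
    top = place E (output C)

  -- The output gate may be placed below the root, with some variables outside its subtree. Those
  -- variables cannot influence the function, so essential ones must occur below the output.
  contains : ∀ i → occurs (subtree top) (x i) ≡ true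
  contains i with a , a′ , agree , differ ← essential i = ¬-not λ absent →
    differ (trans (sym (represents a)) (trans (value-local (output C) λ y sy →
      agree y λ y≡x → not-¬ absent (trans (cong (occurs (subtree top)) (sym y≡x)) sy)) (represents a′)))

  -- Two of the `x` below `t` exclude that `t` is a leaf, where the gates are inputs instead of
  -- or-gates.
  cover : ∀ {t c} → ChildOf c top → Below t c → 1 < weightAt t → Cover (occurs (subtree t)) f (orCount E t)
  cover {t} ch b 1<w = record
    { side   = λ g a → valueAt C a (List.lookup (orGatesAt t) g)
    ; local  = λ g agree → value-local _ λ y sy → agree y
        (trans (cong (λ p → occurs (subtree p) y) (sym (proj₂ (∈-orGatesAt⁻ (∈-lookup {xs = orGatesAt t} g))))) sy)
    ; covers = λ a fa →
        let g , isO , at , valg , lift = through inner ch b (trans (represents a) fa)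
            g∈ = ∈-orGatesAt⁺ isO at
        in index g∈ , subst (λ u → valueAt C a u ≡ true) (lookup-index g∈) valg ,
           λ a′ agree e → trans (sym (represents a′))
             (lift a′ agree (subst (λ u → valueAt C a′ u ≡ true) (sym (lookup-index g∈)) e))
    }
    where
    inner : ∀ {y} → subtree t ≢ leaf y
    inner e = <⇒≱ 1<w (weightAt-leaf t e)

  balanced-cover : ∀ θ → 1 ≤ θ → 2 * θ < n → ∃ λ (t : Node T) → let A = occurs (subtree t) in
    θ < cnt (A ∘ x) × cnt (A ∘ x) ≤ 2 * θ × Cover A f (orCount E t)
  balanced-cover θ 1≤θ 2θ<n
    with t , c , ch , b , θ< , ≤2θ ← descend θ 1≤θ _ top refl (subst (2 * θ <_) (sym (cnt-full contains)) 2θ<n) =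
    t , θ< , ≤2θ , cover ch b (≤-trans (s≤s 1≤θ) θ<)

-- Fooling sets

mix : ∀ {m} → (Fin m → Bool) → Assignment m → Assignment m → Assignment m
mix A a b x = if A x then a x else b x

mix-in : ∀ {m} (A : Fin m → Bool) a b {x} → A x ≡ true → mix A a b x ≡ a x
mix-in A a b e rewrite e = refl

mix-out : ∀ {m} (A : Fin m → Bool) a b {x} → A x ≡ false → mix A a b x ≡ b x
mix-out A a b e rewrite e = refl

record Fooling {m} (A : Fin m → Bool) (f : Assignment m → Bool) (F : ℕ) : Set where
  field
    point    : Fin F → Assignment m
    positive : ∀ u → f (point u) ≡ true
    fools    : ∀ u v → f (mix A (point u) (point v)) ≡ true → f (mix A (point v) (point u)) ≡ true → u ≡ v

-- Two points covered by the same rectangle may exchange their parts on `A`, so both mixes satisfy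
-- `f`.
cover-bound : ∀ {m} {A : Fin m → Bool} {f F W} → Cover A f W → Fooling A f F → F ≤ W
cover-bound {A = A} {f} {F} {W} cover fooling = ≮⇒≥ λ W<F →
  let u , v , u<v , same = pigeonhole W<F rectangle
  in <ᶠ⇒≢ u<v (fools u v (mixes v u (sym same)) (mixes u v same))
  where
  open Cover cover
  open Fooling fooling
  rectangle : Fin F → Fin W
  rectangle u = proj₁ (covers (point u) (positive u))
  mixes : ∀ u v → rectangle u ≡ rectangle v → f (mix A (point v) (point u)) ≡ true
  mixes u v same with covers (point u) (positive u) | covers (point v) (positive v)
  mixes u v refl | g , _ , lift | .g , e , _ =
    lift _ (λ x → mix-out A (point v) (point u)) (trans (local g λ x → mix-in A (point v) (point u)) e)

-- On A, a point acts on the cover of not ∘ f only through its vector of side values.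
cover-bound-not : ∀ {m} {A : Fin m → Bool} {f F W} → Cover A (not ∘ f) W → Fooling A f F → F ≤ 2 ^ W
cover-bound-not {A = A} {f} {F} {W} cover fooling = ≮⇒≥ λ W<F →
  let u , v , u<v , same = pigeonhole W<F (λ u → unbits (sides u))
      sides≡ = λ g → trans (sym (bits-unbits (sides u) g))
                 (trans (cong (λ c → bits c g) same) (bits-unbits (sides v) g))
  in <ᶠ⇒≢ u<v (fools u v (mixes u v sides≡) (mixes v u (sym ∘ sides≡)))
  where
  open Cover cover
  open Fooling fooling
  sides : Fin F → Fin W → Bool
  sides u g = side g (point u)
  mixes : ∀ u v → (∀ g → side g (point u) ≡ side g (point v)) → f (mix A (point u) (point v)) ≡ true
  mixes u v sides≡ = ¬-not λ fmix →
    let g , e , lift = covers (mix A (point u) (point v)) (cong not fmix)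
        not-f = lift (point v) (λ x out → sym (mix-out A (point u) (point v) out))
                  (trans (sym (sides≡ g)) (trans (sym (local g λ x → mix-in A (point u) (point v))) e))
    in not-¬ not-f (cong not (positive v))

-- Automata as structured DNNFs

-- The right-linear vtree in the reading order `f`; the last variable is the bottom leaf. A general
-- `f` lets the recursion pass to `f ∘ suc`, while the automata use `id`.
comb : ∀ k {m} → (Fin (suc k) → Fin m) → VTree m
comb zero    f = leaf (f zero)
comb (suc k) f = node (leaf (f zero)) (comb k (f ∘ suc))

module _ {m : ℕ} where

  nodeAt : ∀ {k} (f : Fin (suc k) → Fin m) → Fin (suc k) → Node (comb k f)
  nodeAt         f zero    = root
  nodeAt {suc k} f (suc d) = right (nodeAt (f ∘ suc) d)

  leafAt : ∀ {k} (f : Fin (suc k) → Fin m) → Fin k → Node (comb k f)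
  leafAt {suc k} f zero    = left root
  leafAt {suc k} f (suc i) = right (leafAt (f ∘ suc) i)

  subtree-leafAt : ∀ {k} (f : Fin (suc k) → Fin m) i → subtree (leafAt f i) ≡ leaf (f (inject₁ i))
  subtree-leafAt {suc k} f zero    = refl
  subtree-leafAt {suc k} f (suc i) = subtree-leafAt (f ∘ suc) i

  subtree-bottom : ∀ {k} (f : Fin (suc k) → Fin m) → subtree (nodeAt f (fromℕ k)) ≡ leaf (f (fromℕ k))
  subtree-bottom {zero}  f = refl
  subtree-bottom {suc k} f = subtree-bottom (f ∘ suc)

  subtree-inner : ∀ {k} (f : Fin (suc k) → Fin m) i {x} → subtree (nodeAt f (inject₁ i)) ≢ leaf x
  subtree-inner {suc k} f (suc i) e = subtree-inner (f ∘ suc) i e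

  leafAt-child : ∀ {k} (f : Fin (suc k) → Fin m) i → ChildOf (leafAt f i) (nodeAt f (inject₁ i))
  leafAt-child {suc k} f zero    = c-left
  leafAt-child {suc k} f (suc i) = in-right (leafAt-child (f ∘ suc) i)

  nodeAt-child : ∀ {k} (f : Fin (suc k) → Fin m) i → ChildOf (nodeAt f (suc i)) (nodeAt f (inject₁ i))
  nodeAt-child {suc k} f zero    = c-right
  nodeAt-child {suc k} f (suc i) = in-right (nodeAt-child (f ∘ suc) i)

  leafAt≢nodeAt : ∀ {k} (f : Fin (suc k) → Fin m) i d → leafAt f i ≢ nodeAt f d
  leafAt≢nodeAt {suc k} f zero    zero    ()
  leafAt≢nodeAt {suc k} f zero    (suc d) ()
  leafAt≢nodeAt {suc k} f (suc i) zero    ()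
  leafAt≢nodeAt {suc k} f (suc i) (suc d) e = leafAt≢nodeAt (f ∘ suc) i d (right-inj e)

  nodeAt-injective : ∀ {k} (f : Fin (suc k) → Fin m) {d d′} → nodeAt f d ≡ nodeAt f d′ → d ≡ d′
  nodeAt-injective         f {zero}  {zero}   e = refl
  nodeAt-injective {suc k} f {zero}  {suc d′} ()
  nodeAt-injective {suc k} f {suc d} {zero}   ()
  nodeAt-injective {suc k} f {suc d} {suc d′} e = cong suc (nodeAt-injective (f ∘ suc) (right-inj e))

  comb-leaf : ∀ {k} (f : Fin (suc k) → Fin m) (p : Node (comb k f)) {x} → subtree p ≡ leaf x → ∃ λ d → f d ≡ x
  comb-leaf {zero}  f root        refl = zero , refl
  comb-leaf {suc k} f (left root) refl = zero , refl
  comb-leaf {suc k} f (right p)   e    = let d , eq = comb-leaf (f ∘ suc) p e in suc d , eq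

  comb-unique : ∀ {k} (f : Fin (suc k) → Fin m) → (∀ d d′ → f d ≡ f d′ → d ≡ d′) → UniqueLeaves (comb k f)
  comb-unique {zero}  f inj root        root        x e e′ = refl
  comb-unique {suc k} f inj (left root) (left root) x e e′ = refl
  comb-unique {suc k} f inj (right p)   (right q)   x e e′ =
    cong right (comb-unique (f ∘ suc) (λ d d′ eq → suc-injectiveᶠ (inj (suc d) (suc d′) eq)) p q x e e′)
  comb-unique {suc k} f inj (left root) (right q)   x refl e′
    with d , eq ← comb-leaf (f ∘ suc) q e′ with () ← inj (suc d) zero eq
  comb-unique {suc k} f inj (right p)   (left root) x e refl
    with d , eq ← comb-leaf (f ∘ suc) p e with () ← inj (suc d) zero eq

toBool : Fin 2 → Bool
toBool = Inverse.to 2↔Bool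

fromBool : Bool → Fin 2
fromBool = Inverse.from 2↔Bool

data Slot (w : ℕ) : Set where
  lit : Bool → Slot w
  and : Bool → Fin w → Slot w
  or  : Fin w → Slot w

module _ {w : ℕ} where

  -- Literals come before and-gates and and-gates before or-gates, the direction of the wires inside
  -- one level. An and-gate is indexed by the literal read and the state entered, so all or-gates of
  -- its level share it.
  encodeSlot : Slot w → Fin (2 + (2 * w + w))
  encodeSlot (lit b)   = fromBool b ↑ˡ (2 * w + w)
  encodeSlot (and b s) = 2 ↑ʳ (combine (fromBool b) s ↑ˡ w)
  encodeSlot (or s)    = 2 ↑ʳ (2 * w ↑ʳ s)

  gateSlot : Fin (2 * w) ⊎ Fin w → Slot w
  gateSlot = [ (λ u → and (toBool (proj₁ (remQuot {2} w u))) (proj₂ (remQuot {2} w u))) , or ]′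

  decodeSlot : Fin (2 + (2 * w + w)) → Slot w
  decodeSlot u = [ lit ∘ toBool , gateSlot ∘ splitAt (2 * w) ]′ (splitAt 2 u)

  decode-encodeSlot : ∀ l → decodeSlot (encodeSlot l) ≡ l
  decode-encodeSlot (lit b)
    rewrite splitAt-↑ˡ 2 (fromBool b) (2 * w + w) = cong lit (Inverse.strictlyInverseˡ 2↔Bool b)
  decode-encodeSlot (and b s)
    rewrite splitAt-↑ʳ 2 (2 * w + w) (combine (fromBool b) s ↑ˡ w)
          | splitAt-↑ˡ (2 * w) (combine (fromBool b) s) w =
    cong₂ and (trans (cong (toBool ∘ proj₁) (remQuot-combine (fromBool b) s)) (Inverse.strictlyInverseˡ 2↔Bool b))
              (cong proj₂ (remQuot-combine (fromBool b) s))
  decode-encodeSlot (or s)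
    rewrite splitAt-↑ʳ 2 (2 * w + w) (2 * w ↑ʳ s) | splitAt-↑ʳ (2 * w) w s = refl

  encode-decodeSlot : ∀ u → encodeSlot (decodeSlot u) ≡ u
  encode-decodeSlot u with splitAt 2 u in eq
  ... | inj₁ b = trans (cong (_↑ˡ (2 * w + w)) (Inverse.strictlyInverseʳ 2↔Bool b)) (splitAt⁻¹-↑ˡ eq)
  ... | inj₂ v with splitAt (2 * w) v in eq′
  ...   | inj₁ c = trans (cong (λ c → 2 ↑ʳ (c ↑ˡ w)) (trans
                     (cong (λ b → combine b (proj₂ (remQuot {2} w c))) (Inverse.strictlyInverseʳ 2↔Bool (proj₁ (remQuot {2} w c))))
                     (combine-remQuot {2} w c)))
                   (trans (cong (2 ↑ʳ_) (splitAt⁻¹-↑ˡ eq′)) (splitAt⁻¹-↑ʳ eq))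
  ...   | inj₂ s = trans (cong (2 ↑ʳ_) (splitAt⁻¹-↑ʳ eq′)) (splitAt⁻¹-↑ʳ eq)

  lit<and : ∀ b b′ s → encodeSlot (lit b) <ᶠ encodeSlot (and b′ s)
  lit<and b b′ s = begin-strict
    toℕ (fromBool b ↑ˡ (2 * w + w))  ≡⟨ toℕ-↑ˡ (fromBool b) (2 * w + w) ⟩
    toℕ (fromBool b)                 <⟨ toℕ<n (fromBool b) ⟩
    2                                ≤⟨ m≤m+n 2 _ ⟩
    2 + toℕ (combine (fromBool b′) s ↑ˡ w) ∎
    where open ≤-Reasoning

  and<or : ∀ b s s′ → encodeSlot (and b s) <ᶠ encodeSlot (or s′)
  and<or b s s′ = s≤s (s≤s (begin-strict
    toℕ (combine (fromBool b) s ↑ˡ w)  ≡⟨ toℕ-↑ˡ (combine (fromBool b) s) w ⟩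
    toℕ (combine (fromBool b) s)       <⟨ toℕ<n (combine (fromBool b) s) ⟩
    2 * w                              ≤⟨ m≤m+n (2 * w) _ ⟩
    2 * w + toℕ s′                     ≡⟨ toℕ-↑ʳ (2 * w) s′ ⟨
    toℕ (2 * w ↑ʳ s′)                  ∎))
    where open ≤-Reasoning

literal : Bool → Bool → Bool
literal b x = if b then x else not x

-- An automaton with state set Fin w reading the variables 0, …, k - 1 in this
-- order; after that it accepts by a literal of the variable k. Every state at
-- every depth of the comb is an or-gate, except at the bottom leaf, where all
-- slots hold literals so that every depth has equally many gates.
module Automaton (k w : ℕ) (next : Fin k → Fin w → List (Bool × Fin w)) (accept : Fin w → Bool) (start : Fin w) where

  slots = 2 + (2 * w + w)

  tree = comb k {suc k} id

  -- Wires lead from deeper levels to shallower ones and must go from smaller to larger numbers,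
  -- hence the reversed depth.
  encode : Fin (suc k) → Slot w → Fin (suc k * slots)
  encode d l = combine (opposite d) (encodeSlot l)

  depth : Fin (suc k * slots) → Fin (suc k)
  depth u = opposite (proj₁ (remQuot {suc k} slots u))

  slot : Fin (suc k * slots) → Slot w
  slot u = decodeSlot (proj₂ (remQuot {suc k} slots u))

  depth-encode : ∀ d l → depth (encode d l) ≡ d
  depth-encode d l = trans (cong (opposite ∘ proj₁) (remQuot-combine (opposite d) (encodeSlot l))) (opposite-involutive d)

  slot-encode : ∀ d l → slot (encode d l) ≡ l
  slot-encode d l = trans (cong (decodeSlot ∘ proj₂) (remQuot-combine (opposite d) (encodeSlot l))) (decode-encodeSlot l)

  encode-decode : ∀ u → encode (depth u) (slot u) ≡ u
  encode-decode u = trans (cong₂ combine (opposite-involutive (proj₁ hc)) (encode-decodeSlot (proj₂ hc)))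
                          (combine-remQuot {suc k} slots u)
    where hc = remQuot {suc k} slots u

  gateAt : Fin (suc k) → Slot w → Gate (suc k) (suc k * slots)
  gateAt d l with view d
  gateAt d (lit b)   | ‵fromℕ     = input d b
  gateAt d (and b s) | ‵fromℕ     = input d b
  gateAt d (or s)    | ‵fromℕ     = input d (accept s)
  gateAt d (lit b)   | ‵inject₁ i = input d b
  gateAt d (and b s) | ‵inject₁ i = and-gate (encode d (lit b) ∷ encode (suc i) (or s) ∷ [])
  gateAt d (or s)    | ‵inject₁ i = or-gate (List.map (λ (b , s′) → encode d (and b s′)) (next i s))

  nodeOf : Fin (suc k) → Slot w → Node tree
  nodeOf d l with view d
  nodeOf d (lit b) | ‵inject₁ i = leafAt id i
  nodeOf d _       | _          = nodeAt id d

  -- The graph of `gateAt` and `nodeOf`: matching on it reveals number, gate and place together,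
  -- where the two functions are stuck on `view d`.
  data Shape : Fin (suc k * slots) → Gate (suc k) (suc k * slots) → Node tree → Set where
    bottom : ∀ l b → Shape (encode (fromℕ k) l) (input (fromℕ k) b) (nodeAt id (fromℕ k))
    lit : ∀ i b → Shape (encode (inject₁ i) (lit b)) (input (inject₁ i) b) (leafAt id i)
    and : ∀ i b s → Shape (encode (inject₁ i) (and b s))
      (and-gate (encode (inject₁ i) (lit b) ∷ encode (suc i) (or s) ∷ [])) (nodeAt id (inject₁ i))
    or : ∀ i s → Shape (encode (inject₁ i) (or s))
      (or-gate (List.map (λ (b , s′) → encode (inject₁ i) (and b s′)) (next i s))) (nodeAt id (inject₁ i))

  shapeAt : ∀ d l → Shape (encode d l) (gateAt d l) (nodeOf d l)
  shapeAt d l with view d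
  shapeAt d (lit b)   | ‵fromℕ     = bottom (lit b) b
  shapeAt d (and b s) | ‵fromℕ     = bottom (and b s) b
  shapeAt d (or s)    | ‵fromℕ     = bottom (or s) (accept s)
  shapeAt d (lit b)   | ‵inject₁ i = lit i b
  shapeAt d (and b s) | ‵inject₁ i = and i b s
  shapeAt d (or s)    | ‵inject₁ i = or i s

  gateOf : Fin (suc k * slots) → Gate (suc k) (suc k * slots)
  gateOf u = gateAt (depth u) (slot u)

  placeOf : Fin (suc k * slots) → Node tree
  placeOf u = nodeOf (depth u) (slot u)

  shape : ∀ u → Shape u (gateOf u) (placeOf u)
  shape u = subst (λ v → Shape v (gateOf u) (placeOf u)) (encode-decode u) (shapeAt (depth u) (slot u))

  gateOf-encode : ∀ d l → gateOf (encode d l) ≡ gateAt d l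
  gateOf-encode d l = cong₂ gateAt (depth-encode d l) (slot-encode d l)

  placeOf-encode : ∀ d l → placeOf (encode d l) ≡ nodeOf d l
  placeOf-encode d l = cong₂ nodeOf (depth-encode d l) (slot-encode d l)

  gate-lit : ∀ i b → gateOf (encode (inject₁ i) (lit b)) ≡ input (inject₁ i) b
  gate-lit i b rewrite gateOf-encode (inject₁ i) (lit b) | view-inject₁ i = refl

  gate-and : ∀ i b s → gateOf (encode (inject₁ i) (and b s)) ≡ and-gate (encode (inject₁ i) (lit b) ∷ encode (suc i) (or s) ∷ [])
  gate-and i b s rewrite gateOf-encode (inject₁ i) (and b s) | view-inject₁ i = refl

  gate-or : ∀ i s → gateOf (encode (inject₁ i) (or s)) ≡ or-gate (List.map (λ (b , s′) → encode (inject₁ i) (and b s′)) (next i s))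
  gate-or i s rewrite gateOf-encode (inject₁ i) (or s) | view-inject₁ i = refl

  gate-bottom : ∀ s → gateOf (encode (fromℕ k) (or s)) ≡ input (fromℕ k) (accept s)
  gate-bottom s rewrite gateOf-encode (fromℕ k) (or s) | view-fromℕ k = refl

  place-lit : ∀ i b → placeOf (encode (inject₁ i) (lit b)) ≡ leafAt id i
  place-lit i b rewrite placeOf-encode (inject₁ i) (lit b) | view-inject₁ i = refl

  place-and : ∀ i b s → placeOf (encode (inject₁ i) (and b s)) ≡ nodeAt id (inject₁ i)
  place-and i b s rewrite placeOf-encode (inject₁ i) (and b s) | view-inject₁ i = refl

  place-or : ∀ d s → placeOf (encode d (or s)) ≡ nodeAt id d
  place-or d s rewrite placeOf-encode d (or s) with view d
  ... | ‵fromℕ     = refl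
  ... | ‵inject₁ i = refl

  sameLevel : ∀ d {l l′} → encodeSlot {w} l <ᶠ encodeSlot l′ → encode d l <ᶠ encode d l′
  sameLevel d {l} {l′} lt = begin-strict
    toℕ (combine (opposite d) (encodeSlot l))            ≡⟨ toℕ-combine (opposite d) (encodeSlot l) ⟩
    slots * toℕ (opposite d) + toℕ (encodeSlot l)        <⟨ +-monoʳ-< (slots * toℕ (opposite d)) lt ⟩
    slots * toℕ (opposite d) + toℕ (encodeSlot l′)       ≡⟨ toℕ-combine (opposite d) (encodeSlot l′) ⟨
    toℕ (combine (opposite d) (encodeSlot l′))           ∎
    where open ≤-Reasoning

  deeper : ∀ i l l′ → encode (suc i) l <ᶠ encode (inject₁ i) l′
  deeper i l l′ = combine-monoˡ-< (encodeSlot l) (encodeSlot l′) (begin-strict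
    toℕ (opposite (suc i))        ≡⟨ opposite-prop (suc i) ⟩
    k ∸ suc (toℕ i)               <⟨ ∸-monoʳ-< (n<1+n (toℕ i)) (toℕ<n i) ⟩
    k ∸ toℕ i                     ≡⟨ cong (k ∸_) (toℕ-inject₁ i) ⟨
    k ∸ toℕ (inject₁ i)           ≡⟨ opposite-prop (inject₁ i) ⟨
    toℕ (opposite (inject₁ i))    ∎)
    where open ≤-Reasoning

  acyclic-shape : ∀ {u v g p} → Shape u g p → v ∈ inputsOf g → v <ᶠ u
  acyclic-shape (and i b s) (here refl)         = sameLevel (inject₁ i) {lit b} {and b s} (lit<and b b s)
  acyclic-shape (and i b s) (there (here refl)) = deeper i (or s) (and b s)
  acyclic-shape (or i s)    v∈ with (b , s′) , _ , refl ← ∈-map⁻ (λ (b , s′) → encode (inject₁ i) (and b s′)) v∈ =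
    sameLevel (inject₁ i) {and b s′} {or s} (and<or b s′ s)

  circ : Circuit (suc k)
  circ = record
    { size    = suc k * slots
    ; gate    = gateOf
    ; acyclic = λ u v → acyclic-shape (shape u)
    ; output  = encode zero (or start)
    }

  isOrAt : ∀ d s → isOr (gateOf (encode d (or s))) ≡ true ⊎ isInput (gateOf (encode d (or s))) ≡ true
  isOrAt d s rewrite gateOf-encode d (or s) with view d
  ... | ‵fromℕ     = inj₂ refl
  ... | ‵inject₁ i = inj₁ refl

  wires-shape : ∀ {v u g p} → Shape v g p → u ∈ inputsOf g →
    (isAnd g ≡ true × (isOr (gateOf u) ≡ true ⊎ isInput (gateOf u) ≡ true) × ChildOf (placeOf u) p)
    ⊎ (isOr g ≡ true × isAnd (gateOf u) ≡ true × placeOf u ≡ p)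
  wires-shape (and i b s) (here refl)         =
    inj₁ (refl , inj₂ (cong isInput (gate-lit i b)) , subst (λ c → ChildOf c _) (sym (place-lit i b)) (leafAt-child id i))
  wires-shape (and i b s) (there (here refl)) =
    inj₁ (refl , isOrAt (suc i) s , subst (λ c → ChildOf c _) (sym (place-or (suc i) s)) (nodeAt-child id i))
  wires-shape (or i s)    u∈ with (b , s′) , _ , refl ← ∈-map⁻ (λ (b , s′) → encode (inject₁ i) (and b s′)) u∈ =
    inj₂ (refl , cong isAnd (gate-and i b s′) , place-and i b s′)

  fanin-shape : ∀ {u g p vs} → Shape u g p → g ≡ and-gate vs →
    ∃ λ v₁ → ∃ λ v₂ → vs ≡ v₁ ∷ v₂ ∷ [] × placeOf v₁ ≢ placeOf v₂
  fanin-shape (and i b s) refl = _ , _ , refl , λ e →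
    leafAt≢nodeAt id i (suc i) (trans (sym (place-lit i b)) (trans e (place-or (suc i) s)))

  leaf-shape : ∀ {u g p x} → Shape u g p → subtree p ≡ leaf x → ∃ λ b → g ≡ input x b
  leaf-shape (bottom l b) e with refl ← trans (sym (subtree-bottom {k = k} id)) e = b , refl
  leaf-shape (lit i b)    e with refl ← trans (sym (subtree-leafAt id i)) e = b , refl
  leaf-shape (and i b s)  e = contradiction e (subtree-inner id i)
  leaf-shape (or i s)     e = contradiction e (subtree-inner id i)

  input-shape : ∀ {u g p x b} → Shape u g p → g ≡ input x b → subtree p ≡ leaf x
  input-shape (bottom l b) refl = subtree-bottom {k = k} id
  input-shape (lit i b)    refl = subtree-leafAt id i

  unique-tree : UniqueLeaves tree
  unique-tree = comb-unique id λ _ _ e → e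

  mentioned : ∀ x → VarOf circ x × ∃ λ (p : Node tree) → subtree p ≡ leaf x
  mentioned x with view x
  ... | ‵fromℕ     = (encode (fromℕ k) (or start) , accept start , gate-bottom start) , nodeAt id (fromℕ k) , subtree-bottom {k = k} id
  ... | ‵inject₁ i = (encode (inject₁ i) (lit true) , true , gate-lit i true) , leafAt id i , subtree-leafAt id i

  open Placed circ placeOf (λ {u} {x} {b} → input-shape {u} {b = b} (shape u)) (λ v u → wires-shape (shape v)) using (varIn-scope; and-wire)

  decomposable-circ : Decomposable circ
  decomposable-circ u vs eq v₁ v₂ v₁∈ v₂∈ v₁≢v₂ x in₁ in₂
    with w₁ , w₂ , refl , ne ← fanin-shape (shape u) eq =
    siblings-disjoint unique-tree (proj₂ (and-wire {u} eq v₁∈)) (proj₂ (and-wire {u} eq v₂∈))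
      (apart v₁∈ v₂∈ v₁≢v₂) (varIn-scope {v₁} in₁) (varIn-scope {v₂} in₂)
    where
    apart : ∀ {v v′} → v ∈ w₁ ∷ w₂ ∷ [] → v′ ∈ w₁ ∷ w₂ ∷ [] → v ≢ v′ → placeOf v ≢ placeOf v′
    apart (here refl)         (here refl)         v≢v′ = contradiction refl v≢v′
    apart (here refl)         (there (here refl)) v≢v′ = ne
    apart (there (here refl)) (here refl)         v≢v′ = ne ∘ sym
    apart (there (here refl)) (there (here refl)) v≢v′ = contradiction refl v≢v′

  dnnf : CSDNNF (suc k) tree
  dnnf = record
    { circuit    = circ
    ; place      = placeOf
    ; structured = record
      { decomposable     = decomposable-circ
      ; vtree-for        = unique-tree , λ x → (λ _ → proj₂ (mentioned x)) , λ _ → proj₁ (mentioned x)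
      ; leaf-gates       = λ u x → leaf-shape (shape u)
      ; inputs-at-leaves = λ u x b e → x , input-shape (shape u) e
      ; and-fanin        = λ u vs → fanin-shape (shape u)
      ; wires            = λ v u → wires-shape (shape v)
      }
    }

  open Cut dnnf using (orGatesAt; ∈-orGatesAt⁺; ∈-orGatesAt⁻)

  or-shape : ∀ {u g p} → Shape u g p → isOr g ≡ true → ∃ λ i → ∃ λ s → u ≡ encode (inject₁ i) (or s) × p ≡ nodeAt id (inject₁ i)
  or-shape (or i s) _ = i , s , refl , refl

  encode-injective : ∀ d {l l′} → encode d l ≡ encode d l′ → l ≡ l′
  encode-injective d e = trans (sym (slot-encode d _)) (trans (cong slot e) (slot-encode d _))

  -- The filtered gate list and the list of the or-slots at this level are duplicate-free with the
  -- same members, hence permutations of each other.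
  orCount-inner : ∀ i → orCount dnnf (nodeAt id (inject₁ i)) ≡ w
  orCount-inner i = begin
    length (orGatesAt t)                    ≡⟨ ↭-length (∼bag⇒↭ (unique∧set⇒bag unique₁ unique₂ λ {u} → mk⇔ to from)) ⟩
    length (List.map orGate (allFin w))     ≡⟨ length-map orGate (allFin w) ⟩
    length (allFin w)                       ≡⟨ length-tabulate id ⟩
    w                                       ∎
    where
    open ≡-Reasoning
    t = nodeAt id (inject₁ i)
    orGate : Fin w → Fin (suc k * slots)
    orGate s = encode (inject₁ i) (or s)
    unique₁ = filter⁺ (λ u → T? (isOr (gateOf u) ∧ ⌊ placeOf u ≟N t ⌋)) (allFin⁺ (suc k * slots))
    unique₂ = map⁺ {f = orGate} (λ e → or-injective (encode-injective (inject₁ i) e)) (allFin⁺ w)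
      where
      or-injective : ∀ {s s′ : Fin w} → Slot.or s ≡ or s′ → s ≡ s′
      or-injective refl = refl
    to : ∀ {u} → u ∈ orGatesAt t → u ∈ List.map orGate (allFin w)
    to {u} u∈ with isO , at ← ∈-orGatesAt⁻ {t} u∈ with j , s , refl , at′ ← or-shape (shape u) isO
      with refl ← inject₁-injective (nodeAt-injective id (trans (sym at′) at)) = ∈-map⁺ orGate (∈-allFin s)
    from : ∀ {u} → u ∈ List.map orGate (allFin w) → u ∈ orGatesAt t
    from u∈ with s , _ , refl ← ∈-map⁻ orGate u∈ = ∈-orGatesAt⁺ (cong isOr (gate-or i s)) (place-or (inject₁ i) s)

  -- Any or-gate found at `t` shows that `t` is an inner spine node, where the count is known;
  -- without one the count is zero.
  orCount-≤ : ∀ t → orCount dnnf t ≤ w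
  orCount-≤ t = at-most (orGatesAt t) λ {u} u∈ →
    let isO , at = ∈-orGatesAt⁻ {t} u∈
        i , _ , _ , at′ = or-shape (shape u) isO
    in ≤-reflexive (trans (cong (orCount dnnf) (trans (sym at) at′)) (orCount-inner i))
    where
    at-most : ∀ {A : Set} (xs : List A) {n} → (∀ {x} → x ∈ xs → length xs ≤ n) → length xs ≤ n
    at-most []       h = z≤n
    at-most (x ∷ xs) h = h (here refl)

  -- The argument of type `Fin k` supplies an inner node at which the width is attained.
  hasWidth : Fin k → HasWidth dnnf w
  hasWidth i = orCount-≤ , nodeAt id (inject₁ i) , orCount-inner i

  value : Assignment (suc k) → Fin (suc k) → Fin w → Bool
  value a d s = valueAt circ a (encode d (or s))

  value-bottom : ∀ a s → value a (fromℕ k) s ≡ literal (accept s) (a (fromℕ k))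
  value-bottom a s = value-input circ a {encode (fromℕ k) (or s)} (gate-bottom s)

  value-lit : ∀ a i b → valueAt circ a (encode (inject₁ i) (lit b)) ≡ literal b (a (inject₁ i))
  value-lit a i b = value-input circ a {encode (inject₁ i) (lit b)} (gate-lit i b)

  value-and-encode : ∀ a i b s → valueAt circ a (encode (inject₁ i) (and b s)) ≡ literal b (a (inject₁ i)) ∧ value a (suc i) s
  value-and-encode a i b s = trans (value-and circ a {encode (inject₁ i) (and b s)} (gate-and i b s))
    (cong₂ _∧_ (value-lit a i b) (∧-identityʳ (value a (suc i) s)))

  value-inner : ∀ a i s → value a (inject₁ i) s ≡ any (λ (b , s′) → literal b (a (inject₁ i)) ∧ value a (suc i) s′) (next i s)
  value-inner a i s = begin
    value a (inject₁ i) s                                                    ≡⟨ value-or circ a {encode (inject₁ i) (or s)} (gate-or i s) ⟩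
    any (valueAt circ a) (List.map (λ (b , s′) → encode (inject₁ i) (and b s′)) (next i s))  ≡⟨ any-map (valueAt circ a) _ (next i s) ⟩
    any (λ (b , s′) → valueAt circ a (encode (inject₁ i) (and b s′))) (next i s)  ≡⟨ any-cong (λ (b , s′) → value-and-encode a i b s′) (next i s) ⟩
    any (λ (b , s′) → literal b (a (inject₁ i)) ∧ value a (suc i) s′) (next i s)  ∎
    where open ≡-Reasoning

  -- All inputs of an or-gate read the same variable, so it suffices that distinct transitions read
  -- opposite literals.
  deterministic : (∀ i s {b b′ s′ s″} → (b , s′) ∈ next i s → (b′ , s″) ∈ next i s → (b , s′) ≢ (b′ , s″) → b ≢ b′) →
    Deterministic circ
  deterministic sep u vs = det (shape u)
    where
    opposite-literals : ∀ b b′ x → b ≢ b′ → literal b x ≡ true → literal b′ x ≡ true → ⊥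
    opposite-literals true  true  x     ne e e′ = ne refl
    opposite-literals false false x     ne e e′ = ne refl
    opposite-literals true  false true  ne e ()
    opposite-literals false true  false ne e ()
    det : ∀ {u g p vs} → Shape u g p → g ≡ or-gate vs → ∀ v₁ v₂ → v₁ ∈ vs → v₂ ∈ vs → v₁ ≢ v₂ →
      ∀ a → valueAt circ a v₁ ≡ true → valueAt circ a v₂ ≡ true → ⊥
    det (or i s) refl v₁ v₂ v₁∈ v₂∈ ne a e₁ e₂
      with (b , s′) , m , refl ← ∈-map⁻ (λ (b , s′) → encode (inject₁ i) (and b s′)) v₁∈
         | (b′ , s″) , m′ , refl ← ∈-map⁻ (λ (b , s′) → encode (inject₁ i) (and b s′)) v₂∈ =
      opposite-literals b b′ (a (inject₁ i)) (sep i s m m′ λ e → ne (cong (λ (b , s′) → encode (inject₁ i) (and b s′)) e))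
        (proj₁ (∧-true (trans (sym (value-and-encode a i b s′)) e₁)))
        (proj₁ (∧-true (trans (sym (value-and-encode a i b′ s″)) e₂)))

-- Runs of a two-state process

run : ∀ {k} → (Fin k → Bool → Bool → Bool) → (Fin k → Bool) → Fin (suc k) → Bool → Bool
run {zero}  st a zero    p = p
run {suc k} st a zero    p = run (st ∘ suc) (a ∘ suc) zero (st zero p (a zero))
run {suc k} st a (suc d) p = run (st ∘ suc) (a ∘ suc) d p

run-bottom : ∀ {k} (st : Fin k → Bool → Bool → Bool) a p → run st a (fromℕ k) p ≡ p
run-bottom {zero}  st a p = refl
run-bottom {suc k} st a p = run-bottom (st ∘ suc) (a ∘ suc) p

run-inner : ∀ {k} (st : Fin k → Bool → Bool → Bool) a i p →
  run st a (inject₁ i) p ≡ run st a (suc i) (st i p (a i))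
run-inner {suc k} st a zero    p = refl
run-inner {suc k} st a (suc i) p = run-inner (st ∘ suc) (a ∘ suc) i p

run-cong : ∀ {k} {st st′ : Fin k → Bool → Bool → Bool} → (∀ i p b → st i p b ≡ st′ i p b) →
  ∀ a p → run st a zero p ≡ run st′ a zero p
run-cong {zero}            eq a p = refl
run-cong {suc k} {st′ = st′} eq a p =
  trans (run-cong (eq ∘ suc) (a ∘ suc) _) (cong (run (st′ ∘ suc) (a ∘ suc) zero) (eq zero p (a zero)))

run-+ : ∀ q {n} (st : Fin (q + n) → Bool → Bool → Bool) a p →
  run st a zero p ≡ run (st ∘ (q ↑ʳ_)) (a ∘ (q ↑ʳ_)) zero (run (st ∘ (_↑ˡ n)) (a ∘ (_↑ˡ n)) zero p)
run-+ zero    st a p = refl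
run-+ (suc q) st a p = run-+ q (st ∘ suc) (a ∘ suc) (st zero p (a zero))

run-xor : ∀ {q} (f a : Fin q → Bool) p → run (λ j p b → p xor (f j ∧ b)) a zero p ≡ p xor dot f a
run-xor {zero}  f a false = refl
run-xor {zero}  f a true  = refl
run-xor {suc q} f a p     = trans (run-xor (f ∘ suc) (a ∘ suc) _) (xor-assoc p _ _)

run-idle : ∀ {n} (a : Fin n → Bool) p → run (λ _ p _ → p ∨ false) a zero p ≡ p
run-idle {zero}  a p = refl
run-idle {suc n} a p = trans (run-idle (a ∘ suc) _) (∨-identityʳ p)

run-∨ : ∀ {n} (i : Fin n) a p → run (λ i′ p b → p ∨ (does (i ≟ i′) ∧ b)) a zero p ≡ p ∨ a i
run-∨ {suc n} zero    a p = run-idle (a ∘ suc) (p ∨ a zero)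
run-∨ {suc n} (suc i) a p = trans (run-∨ i (a ∘ suc) _) (cong (_∨ a (suc i)) (∨-identityʳ p))

branches : ∀ {w} → (Bool → Fin w) → List (Bool × Fin w)
branches s = (false , s false) ∷ (true , s true) ∷ []

any-branches : ∀ {w} (v : Fin w → Bool) x s →
  any (λ (b , s′) → literal b x ∧ v s′) (branches s) ≡ v (s x)
any-branches v true  s = ∨-identityʳ (v (s true))
any-branches v false s = ∨-identityʳ (v (s false))

-- The states in the image of `σ` run the Boolean process `st`, whatever the other states do. This
-- serves `D i`, with `fromBool` as `σ`, and also the copy of `D i` inside `E` once `i` is guessed.
-- The induction goes from the bottom of the comb upwards.
module Simulation {k w} (next : Fin k → Fin w → List (Bool × Fin w)) (accept : Fin w → Bool) (start : Fin w)
  (st : Fin k → Bool → Bool → Bool) (σ : Bool → Fin w) (next-σ : ∀ i p → next i (σ p) ≡ branches (σ ∘ st i p)) where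

  open Automaton k w next accept start

  value-σ : ∀ a d p → value a d (σ p) ≡ literal (accept (σ (run st (a ∘ inject₁) d p))) (a (fromℕ k))
  value-σ a = >-weakInduction (λ d → ∀ p → value a d (σ p) ≡ literal (accept (σ (run st (a ∘ inject₁) d p))) (a (fromℕ k)))
    (λ p → trans (value-bottom a (σ p)) (cong (λ p → literal (accept (σ p)) (a (fromℕ k))) (sym (run-bottom st (a ∘ inject₁) p))))
    λ i ih p → begin
      value a (inject₁ i) (σ p)
        ≡⟨ value-inner a i (σ p) ⟩
      any (λ (b , s′) → literal b (a (inject₁ i)) ∧ value a (suc i) s′) (next i (σ p))
        ≡⟨ cong (any _) (next-σ i p) ⟩
      any (λ (b , s′) → literal b (a (inject₁ i)) ∧ value a (suc i) s′) (branches (σ ∘ st i p))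
        ≡⟨ any-branches (value a (suc i)) (a (inject₁ i)) (σ ∘ st i p) ⟩
      value a (suc i) (σ (st i p (a (inject₁ i))))
        ≡⟨ ih _ ⟩
      literal (accept (σ (run st (a ∘ inject₁) (suc i) (st i p (a (inject₁ i)))))) (a (fromℕ k))
        ≡⟨ cong (λ p → literal (accept (σ p)) (a (fromℕ k))) (run-inner st (a ∘ inject₁) i p) ⟨
      literal (accept (σ (run st (a ∘ inject₁) (inject₁ i) p))) (a (fromℕ k)) ∎
    where open ≡-Reasoning

⋀-true : ∀ {n} {g : Fin n → Bool} → (∀ i → g i ≡ true) → ⋀ n g ≡ true
⋀-true {zero}  h = refl
⋀-true {suc n} h rewrite h zero = ⋀-true (h ∘ suc)

⋀-elim : ∀ {n} {g : Fin n → Bool} → ⋀ n g ≡ true → ∀ i → g i ≡ true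
⋀-elim e zero    = proj₁ (∧-true e)
⋀-elim e (suc i) = ⋀-elim (proj₂ (∧-true e)) i

⋁-not : ∀ {n} (g : Fin n → Bool) → ⋁ n (not ∘ g) ≡ not (⋀ n g)
⋁-not {zero}  g = refl
⋁-not {suc n} g with g zero
... | true  = ⋁-not (g ∘ suc)
... | false = refl

⋁-cong : ∀ {n} {g h : Fin n → Bool} → g ≗ h → ⋁ n g ≡ ⋁ n h
⋁-cong {zero}  eq = refl
⋁-cong {suc n} eq = cong₂ _∨_ (eq zero) (⋁-cong (eq ∘ suc))

any-++ : ∀ {A : Set} (p : A → Bool) xs {ys} → any p (xs List.++ ys) ≡ any p xs ∨ any p ys
any-++ p []       = refl
any-++ p (x ∷ xs) = trans (cong (p x ∨_) (any-++ p xs)) (sym (∨-assoc (p x) _ _))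

any-concatMap : ∀ {A B : Set} (p : B → Bool) (f : A → List B) n (h : Fin n → A) →
  any p (List.concatMap f (List.tabulate h)) ≡ ⋁ n (λ i → any p (f (h i)))
any-concatMap p f zero    h = refl
any-concatMap p f (suc n) h = trans (any-++ p (f (h zero))) (cong (any p (f (h zero)) ∨_) (any-concatMap p f n (h ∘ suc)))

-- The hard instance

-- The variable y at the bottom is there because the bottom leaf of the comb only
-- carries literals, so that a run must end by reading a variable.
module Variables (n : ℕ) (M : Fin n → Fin (suc n) → Bool) where

  -- The extra column makes `k` positive for every `n`, so the comb has an inner node for `E-width`
  -- and a first variable at which `E` can guess.
  q = suc n
  k = q + n

  z : Fin q → Fin (suc k)
  z j = inject₁ (j ↑ˡ n)
  x : Fin n → Fin (suc k)
  x i = inject₁ (q ↑ʳ i)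
  y : Fin (suc k)
  y = fromℕ k

  clause : Fin n → Assignment (suc k) → Bool
  clause i a = dot (M i) (a ∘ z) ∨ a (x i)

module Instance (n : ℕ) (M : Fin n → Fin (suc n) → Bool) where

  open Variables n M

  step : Fin n → Fin k → Bool → Bool → Bool
  step i h p b = [ (λ j → p xor (M i j ∧ b)) , (λ i′ → p ∨ (does (i ≟ i′) ∧ b)) ]′ (splitAt q h)

  step-z : ∀ i j p b → step i (j ↑ˡ n) p b ≡ p xor (M i j ∧ b)
  step-z i j p b rewrite splitAt-↑ˡ q j n = refl

  step-x : ∀ i i′ p b → step i (q ↑ʳ i′) p b ≡ p ∨ (does (i ≟ i′) ∧ b)
  step-x i i′ p b rewrite splitAt-↑ʳ q n i′ = refl

  run-step : ∀ i a → run (step i) (a ∘ inject₁) zero false ≡ clause i a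
  run-step i a = begin
    run (step i) (a ∘ inject₁) zero false
      ≡⟨ run-+ q (step i) (a ∘ inject₁) false ⟩
    run (step i ∘ (q ↑ʳ_)) (a ∘ x) zero (run (step i ∘ (_↑ˡ n)) (a ∘ z) zero false)
      ≡⟨ run-cong (step-x i) (a ∘ x) _ ⟩
    run (λ i′ p b → p ∨ (does (i ≟ i′) ∧ b)) (a ∘ x) zero (run (step i ∘ (_↑ˡ n)) (a ∘ z) zero false)
      ≡⟨ run-∨ i (a ∘ x) _ ⟩
    run (step i ∘ (_↑ˡ n)) (a ∘ z) zero false ∨ a (x i)
      ≡⟨ cong (_∨ a (x i)) (run-cong (step-z i) (a ∘ z) false) ⟩
    run (λ j p b → p xor (M i j ∧ b)) (a ∘ z) zero false ∨ a (x i)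
      ≡⟨ cong (_∨ a (x i)) (run-xor (M i) (a ∘ z) false) ⟩
    clause i a ∎
    where open ≡-Reasoning

  next₁ : Fin n → Fin k → Fin 2 → List (Bool × Fin 2)
  next₁ i h s = branches (fromBool ∘ step i h (toBool s))

  D : Fin n → CSDNNF (suc k) (comb k id)
  D i = Automaton.dnnf k 2 (next₁ i) toBool zero

  D-deterministic : ∀ i → IsDeterministic (D i)
  D-deterministic i = Automaton.deterministic k 2 (next₁ i) toBool zero separated
    where
    separated : ∀ h s {b b′ s′ s″} → (b , s′) ∈ next₁ i h s → (b′ , s″) ∈ next₁ i h s →
      (b , s′) ≢ (b′ , s″) → b ≢ b′
    separated h s (here refl)         (here refl)         ne = contradiction refl ne
    separated h s (here refl)         (there (here refl)) ne = λ ()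
    separated h s (there (here refl)) (here refl)         ne = λ ()
    separated h s (there (here refl)) (there (here refl)) ne = contradiction refl ne

  D-width : ∀ i → HasWidth (D i) 2
  D-width i = Automaton.hasWidth k 2 (next₁ i) toBool zero zero

  D-eval : ∀ i a → eval (circuit (D i)) a ≡ literal (clause i a) (a y)
  D-eval i a = trans
    (Simulation.value-σ (next₁ i) toBool zero (step i) fromBool
      (λ h p → cong (λ p → branches (fromBool ∘ step i h p)) (Inverse.strictlyInverseˡ 2↔Bool p)) a zero false)
    (cong (λ p → literal p (a y)) (trans (Inverse.strictlyInverseˡ 2↔Bool _) (run-step i a)))

  -- State suc (combine i p) simulates D i in state p; state zero guesses i.
  next₂ : Fin k → Fin (suc (n * 2)) → List (Bool × Fin (suc (n * 2)))
  next₂ h zero    = List.concatMap (λ i → branches (λ b → suc (combine i (fromBool (step i h false b))))) (allFin n)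
  next₂ h (suc u) = let i , p = remQuot {n} 2 u in branches (λ b → suc (combine i (fromBool (step i h (toBool p) b))))

  -- In its final state `p` the automaton `D i` tests that `y` equals `p`; the negated test is that
  -- `y` equals `not p`, again a literal.
  accept₂ : Fin (suc (n * 2)) → Bool
  accept₂ zero    = false
  accept₂ (suc u) = not (toBool (proj₂ (remQuot {n} 2 u)))

  E : CSDNNF (suc k) (comb k id)
  E = Automaton.dnnf k (suc (n * 2)) next₂ accept₂ zero

  E-width : HasWidth E (suc (n * 2))
  E-width = Automaton.hasWidth k (suc (n * 2)) next₂ accept₂ zero zero

  E-represents : Represents E (disjNegOf D)
  E-represents a = begin
    eval (circuit E) a
      ≡⟨ value-inner a zero zero ⟩
    any (λ (b , s′) → literal b (a zero) ∧ value a (suc zero) s′) (next₂ zero zero)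
      ≡⟨ any-concatMap _ _ n id ⟩
    ⋁ n (λ i → any (λ (b , s′) → literal b (a zero) ∧ value a (suc zero) s′)
                 (branches (λ b → suc (combine i (fromBool (step i zero false b))))))
      ≡⟨ ⋁-cong (λ i → trans (any-branches (value a (suc zero)) (a zero) (σ i ∘ step i zero false)) (guess i)) ⟩
    ⋁ n (λ i → not (eval (circuit (D i)) a)) ∎
    where
    open ≡-Reasoning
    open Automaton k (suc (n * 2)) next₂ accept₂ zero
    σ : Fin n → Bool → Fin (suc (n * 2))
    σ i p = suc (combine i (fromBool p))
    decode-σ : ∀ i p → remQuot {n} 2 (combine i (fromBool p)) ≡ (i , fromBool p)
    decode-σ i p = remQuot-combine i (fromBool p)
    next-σ : ∀ i h p → next₂ h (σ i p) ≡ branches (σ i ∘ step i h p)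
    next-σ i h p = cong₂ (λ i p → branches (λ b → suc (combine i (fromBool (step i h p b)))))
      (cong proj₁ (decode-σ i p)) (trans (cong (toBool ∘ proj₂) (decode-σ i p)) (Inverse.strictlyInverseˡ 2↔Bool p))
    accept-σ : ∀ i p → accept₂ (σ i p) ≡ not p
    accept-σ i p = cong not (trans (cong (toBool ∘ proj₂) (decode-σ i p)) (Inverse.strictlyInverseˡ 2↔Bool p))
    literal-not : ∀ b c → literal (not b) c ≡ not (literal b c)
    literal-not true  c     = refl
    literal-not false true  = refl
    literal-not false false = refl
    guess : ∀ i → value a (suc zero) (σ i (step i zero false (a zero))) ≡ not (eval (circuit (D i)) a)
    guess i = begin
      value a (suc zero) (σ i (step i zero false (a zero)))
        ≡⟨ Simulation.value-σ next₂ accept₂ zero (step i) (σ i) (next-σ i) a (suc zero) _ ⟩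
      literal (accept₂ (σ i (run (step i) (a ∘ inject₁) zero false))) (a y)
        ≡⟨ cong (λ b → literal b (a y)) (trans (accept-σ i _) (cong not (run-step i a))) ⟩
      literal (not (clause i a)) (a y)   ≡⟨ literal-not (clause i a) (a y) ⟩
      not (literal (clause i a) (a y))   ≡⟨ cong not (D-eval i a) ⟨
      not (eval (circuit (D i)) a)       ∎

  conj-intro : ∀ a → a y ≡ true → (∀ i → clause i a ≡ true) → conjOf D a ≡ true
  conj-intro a ay h = ⋀-true λ i → trans (D-eval i a) (cong₂ literal (h i) ay)

  conj-elim : ∀ a → a y ≡ true → conjOf D a ≡ true → ∀ i → clause i a ≡ true
  conj-elim a ay e i = literal-true ay (trans (sym (D-eval i a)) (⋀-elim e i))
    where
    literal-true : ∀ {b c} → c ≡ true → literal b c ≡ true → b ≡ true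
    literal-true {true}  refl _  = refl
    literal-true {false} refl ()

  disjNeg-not : ∀ a → disjNegOf D a ≡ not (conjOf D a)
  disjNeg-not a = ⋁-not (λ i → eval (circuit (D i)) a)

-- The hypotheses describe `f` on the half cube where `y` is true: there it is the conjunction of
-- the clauses. All points of the fooling sets lie in this half, so all their mixes do too.
module Hardness (n : ℕ) (M : Fin n → Fin (suc n) → Bool) (f : Assignment (suc (suc n + n)) → Bool)
  (f-intro : ∀ a → a (fromℕ (suc n + n)) ≡ true → (∀ i → Variables.clause n M i a ≡ true) → f a ≡ true)
  (f-elim : ∀ a → a (fromℕ (suc n + n)) ≡ true → f a ≡ true → ∀ i → Variables.clause n M i a ≡ true) where

  open Variables n M

  assign : (Fin q → Bool) → (Fin n → Bool) → Assignment (suc k)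
  assign zs xs v with view v
  ... | ‵fromℕ     = true
  ... | ‵inject₁ h = [ zs , xs ]′ (splitAt q h)

  assign-z : ∀ zs xs j → assign zs xs (z j) ≡ zs j
  assign-z zs xs j rewrite view-inject₁ (j ↑ˡ n) | splitAt-↑ˡ q j n = refl

  assign-x : ∀ zs xs i → assign zs xs (x i) ≡ xs i
  assign-x zs xs i rewrite view-inject₁ (q ↑ʳ i) | splitAt-↑ʳ q n i = refl

  assign-y : ∀ zs xs → assign zs xs y ≡ true
  assign-y zs xs rewrite view-fromℕ k = refl

  assign-agree : ∀ zs xs xs′ i → (∀ i′ → i′ ≢ i → xs i′ ≡ xs′ i′) → ∀ v → v ≢ x i → assign zs xs v ≡ assign zs xs′ v
  assign-agree zs xs xs′ i agree v v≢x with view v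
  ... | ‵fromℕ     = refl
  ... | ‵inject₁ h with splitAt q h in eq
  ...   | inj₁ j  = refl
  ...   | inj₂ i′ = agree i′ λ { refl → v≢x (cong inject₁ (sym (splitAt⁻¹-↑ʳ {q} eq))) }

  x-injective : ∀ i i′ → x i ≡ x i′ → i ≡ i′
  x-injective i i′ e = ↑ʳ-injective q i i′ (inject₁-injective e)

  zeros : Fin q → Bool
  zeros _ = false

  dot-zeros : ∀ i a → (∀ j → a (z j) ≡ false) → dot (M i) (a ∘ z) ≡ false
  dot-zeros i a h = ⨁-zero λ j → trans (cong (M i j ∧_) (h j)) (∧-zeroʳ (M i j))

  -- With all `z` false, clause `i` reduces to `x i`: setting every `x` satisfies `f`, and switching
  -- off `x i` alone falsifies it.
  x-essential : ∀ i → Essential (f) (x i)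
  x-essential i = on , off , assign-agree zeros _ _ i agree , λ e →
    not-¬ (trans (sym e) on-true) (sym off-false)
    where
    on off : Assignment (suc k)
    on  = assign zeros (λ _ → true)
    off = assign zeros (λ i′ → not (does (i ≟ i′)))
    agree : ∀ i′ → i′ ≢ i → true ≡ not (does (i ≟ i′))
    agree i′ ne = cong not (sym (dec-false (i ≟ i′) (ne ∘ sym)))
    on-true : f on ≡ true
    on-true = f-intro on (assign-y zeros _) λ i′ →
      trans (cong (dot (M i′) (on ∘ z) ∨_) (assign-x zeros _ i′)) (∨-zeroʳ _)
    off-false : false ≡ f off
    off-false = sym (¬-not λ e → not-¬ (f-elim off (assign-y zeros _) e i)
      (cong₂ _∨_ (dot-zeros i off (assign-z zeros _))
                 (trans (assign-x zeros _ i) (cong not (dec-true (i ≟ i) refl)))))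

  x-essential-not : ∀ i → Essential (not ∘ f) (x i)
  x-essential-not i with a , a′ , agree , differ ← x-essential i =
    a , a′ , agree , λ e → differ (not-injective e)

  masked : (Fin n → Bool) → (Fin q → Bool) → Fin n → Fin q → Bool
  masked R C i j = (R i ∧ C j) ∧ M i j

  module _ (A : Fin (suc k) → Bool) (R : Fin n → Bool) (C : Fin q → Bool) {r} (images : ManyImages r (masked R C)) where

    private
      Z = proj₁ images

      -- Columns outside `C` may lie on either side of the cut. Setting them to false in every point
      -- makes mixing leave them unchanged.
      Zᶜ : Fin (2 ^ r) → Fin q → Bool
      Zᶜ u j = C j ∧ Z u j

      dot-masked : ∀ i u → dot (masked R C i) (Z u) ≡ R i ∧ dot (M i) (Zᶜ u)
      dot-masked i u with R i
      ... | true  = sum-cong-≗ λ j → rearrange (C j) (M i j) (Z u j)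
        where
        rearrange : ∀ c m z → (c ∧ m) ∧ z ≡ m ∧ (c ∧ z)
        rearrange false false z = refl
        rearrange false true  z = refl
        rearrange true  false z = refl
        rearrange true  true  z = refl
      ... | false = ⨁-zero {q} λ _ → refl

    -- In a row of `R`, `x i` is the complement of the bit of `M z`, so the clause holds with
    -- nothing to spare; in the other rows `x i` is true.
    point : Fin (2 ^ r) → Assignment (suc k)
    point u = assign (Zᶜ u) (λ i → not (dot (masked R C i) (Z u)))

    point-z : ∀ u j → point u (z j) ≡ Zᶜ u j
    point-z u = assign-z (Zᶜ u) (λ i → not (dot (masked R C i) (Z u)))

    point-x : ∀ u i → point u (x i) ≡ not (dot (masked R C i) (Z u))
    point-x u = assign-x (Zᶜ u) (λ i → not (dot (masked R C i) (Z u)))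

    point-y : ∀ u → point u y ≡ true
    point-y u = assign-y (Zᶜ u) (λ i → not (dot (masked R C i) (Z u)))

    point-positive : ∀ u → f (point u) ≡ true
    point-positive u = f-intro (point u) (point-y u) λ i → begin
      dot (M i) (point u ∘ z) ∨ point u (x i)
        ≡⟨ cong₂ _∨_ (sum-cong-≗ λ j → cong (M i j ∧_) (point-z u j)) (trans (point-x u i) (cong not (dot-masked i u))) ⟩
      dot (M i) (Zᶜ u) ∨ not (R i ∧ dot (M i) (Zᶜ u))
        ≡⟨ tautology (dot (M i) (Zᶜ u)) (R i) ⟩
      true ∎
      where
      open ≡-Reasoning
      tautology : ∀ d r → d ∨ not (r ∧ d) ≡ true
      tautology true  r     = refl
      tautology false false = refl
      tautology false true  = refl

    -- c takes the variables z from point u and the variables x in R from point v.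
    Hybrid : Fin (2 ^ r) → Fin (2 ^ r) → Assignment (suc k) → Set
    Hybrid u v c = (∀ j → c (z j) ≡ Zᶜ u j) × (∀ i → R i ≡ true → c (x i) ≡ point v (x i)) × c y ≡ true

    -- For a row in `R`, the clause on the hybrid says that bit `i` of image `u` is true or bit `i`
    -- of image `v` is false, an implication from `v` to `u`. The opposite hybrid gives the
    -- converse, whence equal images.
    hybrid-≤ : ∀ {u v c} → Hybrid u v c → f c ≡ true →
      ∀ i → dot (masked R C i) (Z v) ≡ true → dot (masked R C i) (Z u) ≡ true
    hybrid-≤ {u} {v} {c} (cz , cx , cy) e i dv = trans (dot-masked i u) (cong₂ _∧_ Ri
      (trans (sym (∨-identityʳ _)) (trans (sym (cong₂ _∨_ (sum-cong-≗ λ j → cong (M i j ∧_) (cz j)) x-off)) (f-elim c cy e i))))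
      where
      Ri : R i ≡ true
      Ri = proj₁ (∧-true (trans (sym (dot-masked i v)) dv))
      x-off : c (x i) ≡ false
      x-off = trans (cx i Ri) (trans (point-x v i) (cong not dv))

    hybrids-equal : ∀ {u v c c′} → Hybrid u v c → Hybrid v u c′ → f c ≡ true → f c′ ≡ true → u ≡ v
    hybrids-equal h h′ e e′ = proj₂ images _ _ λ i → antisym (hybrid-≤ h′ e′ i) (hybrid-≤ h e i)
      where
      antisym : ∀ {b c} → (b ≡ true → c ≡ true) → (c ≡ true → b ≡ true) → b ≡ c
      antisym {true}  {c}     f g = sym (f refl)
      antisym {false} {true}  f g = g refl
      antisym {false} {false} f g = refl

    mix-y : ∀ u v → mix A (point u) (point v) y ≡ true
    mix-y u v with A y
    ... | true  = point-y u
    ... | false = point-y v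

    fooling-in : (∀ j → C j ≡ true → A (z j) ≡ true) → (∀ i → R i ≡ true → A (x i) ≡ false) →
      Fooling A (f) (2 ^ r)
    fooling-in C⊆A R∩A = record { point = point ; positive = point-positive
                                ; fools = λ u v → hybrids-equal (hybrid u v) (hybrid v u) }
      where
      hybrid : ∀ u v → Hybrid u v (mix A (point u) (point v))
      hybrid u v = mix-z , (λ i Ri → mix-out A (point u) (point v) (R∩A i Ri)) , mix-y u v
        where
        mix-z : ∀ j → mix A (point u) (point v) (z j) ≡ Zᶜ u j
        mix-z j with A (z j) | C⊆A j | point-z u j | point-z v j
        ... | true  | _ | eu | _  = eu
        ... | false | h | _  | ev with C j
        ...   | false = ev
        ...   | true with () ← h refl

    fooling-out : (∀ j → C j ≡ true → A (z j) ≡ false) → (∀ i → R i ≡ true → A (x i) ≡ true) →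
      Fooling A (f) (2 ^ r)
    fooling-out C∩A R⊆A = record { point = point ; positive = point-positive
                                 ; fools = λ u v e e′ → hybrids-equal (hybrid u v) (hybrid v u) e′ e }
      where
      hybrid : ∀ u v → Hybrid u v (mix A (point v) (point u))
      hybrid u v = mix-z , (λ i Ri → mix-in A (point v) (point u) (R⊆A i Ri)) , mix-y v u
        where
        mix-z : ∀ j → mix A (point v) (point u) (z j) ≡ Zᶜ u j
        mix-z j with A (z j) | C∩A j | point-z u j | point-z v j
        ... | false | _ | eu | _  = eu
        ... | true  | h | _  | ev with C j
        ...   | false = ev
        ...   | true with () ← h refl

  module _ {r θ} (rigid : Union.Rigid n q r θ M) (2θ≤n : 2 * θ ≤ n) where

    many-images : ∀ R C → θ ≤ cnt R → θ ≤ cnt C → ManyImages r (masked R C)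
    many-images R C θ≤R θ≤C = [ (λ f → contradiction f (rigid R C θ≤R θ≤C)) , id ]′ (factors-or-manyImages r (masked R C))

    fooling : ∀ A → θ ≤ cnt (A ∘ x) → θ ≤ cnt (not ∘ A ∘ x) → Fooling A (f) (2 ^ r)
    fooling A θ≤in θ≤out with θ ≤? cnt (A ∘ z)
    ... | yes θ≤z = fooling-in A (not ∘ A ∘ x) (A ∘ z) {r} (many-images (not ∘ A ∘ x) (A ∘ z) θ≤out θ≤z)
      (λ j e → e) (λ i e → not-injective e)
    ... | no  θ≰z = fooling-out A (A ∘ x) (not ∘ A ∘ z) {r} (many-images (A ∘ x) (not ∘ A ∘ z) θ≤in θ≤z)
      (λ j e → not-injective e) (λ i e → e)
      where
      open ≤-Reasoning
      θ≤z : θ ≤ cnt (not ∘ A ∘ z)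
      θ≤z = +-cancelˡ-≤ (cnt (A ∘ z)) _ _ (begin
        cnt (A ∘ z) + θ                       ≤⟨ +-monoˡ-≤ θ (<⇒≤ (≰⇒> θ≰z)) ⟩
        θ + θ                                 ≡⟨ cong (θ +_) (+-identityʳ θ) ⟨
        2 * θ                                 ≤⟨ 2θ≤n ⟩
        n                                     ≤⟨ n≤1+n n ⟩
        q                                     ≡⟨ cnt-not (A ∘ z) ⟨
        cnt (A ∘ z) + cnt (not ∘ A ∘ z)       ∎)

  module _ {r θ} (rigid : Union.Rigid n q r θ M) (1≤θ : 1 ≤ θ) (3θ≤n : 3 * θ ≤ n) where

    private
      2θ<n : 2 * θ < n
      2θ<n = <-≤-trans (m<n+m (2 * θ) 1≤θ) 3θ≤n

      fooling′ : ∀ A → θ < cnt (A ∘ x) → cnt (A ∘ x) ≤ 2 * θ → Fooling A (f) (2 ^ r)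
      -- At most `2 * θ` of at least `3 * θ` variables `x` lie in `A`, which leaves `θ` of them
      -- outside.
      fooling′ A θ< ≤2θ = fooling rigid (<⇒≤ 2θ<n) A (<⇒≤ θ<) (+-cancelˡ-≤ (2 * θ) _ _ (begin
        2 * θ + θ                             ≡⟨ +-comm (2 * θ) θ ⟩
        3 * θ                                 ≤⟨ 3θ≤n ⟩
        n                                     ≡⟨ cnt-not (A ∘ x) ⟨
        cnt (A ∘ x) + cnt (not ∘ A ∘ x)       ≤⟨ +-monoˡ-≤ _ ≤2θ ⟩
        2 * θ + cnt (not ∘ A ∘ x)             ∎))
        where open ≤-Reasoning

    width : ∀ {T} (F : CSDNNF (suc k) T) {w} → Represents F (f) → HasWidth F w → 2 ^ r ≤ w
    width F rep (≤w , _)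
      with t , θ< , ≤2θ , cover ← Balance.balanced-cover F rep x x-injective x-essential θ 1≤θ 2θ<n =
      ≤-trans (cover-bound cover (fooling′ (occurs (subtree t)) θ< ≤2θ)) (≤w t)

    not-width : ∀ {T} (F : CSDNNF (suc k) T) {w} → Represents F (not ∘ f) → HasWidth F w → 2 ^ r ≤ 2 ^ w
    not-width F rep (≤w , _)
      with t , θ< , ≤2θ , cover ← Balance.balanced-cover F rep
        x x-injective x-essential-not θ 1≤θ 2θ<n =
      ≤-trans (cover-bound-not cover (fooling′ (occurs (subtree t)) θ< ≤2θ)) (^-monoʳ-≤ 2 (≤w t))

-- With n / 24 = suc r and θ = 8 * suc r, both 3 * θ ≤ n and the counting bound
-- (2 * n + 1) * suc r < θ * θ hold as soon as r ≥ 2.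
scale : ∀ n → 72 ≤ n → ∃ λ r → 2 ≤ r × 24 * suc r ≤ n × n < 24 * (2 + r)
scale n 72≤n = go (n / 24) (/-monoˡ-≤ 24 72≤n) (m≡m%n+[m/n]*n n 24)
  where
  go : ∀ ρ → 3 ≤ ρ → n ≡ n % 24 + ρ * 24 → ∃ λ r → 2 ≤ r × 24 * suc r ≤ n × n < 24 * (2 + r)
  go (suc r) (s≤s 2≤r) eq = r , 2≤r , lower , upper
    where
    open ≤-Reasoning
    lower : 24 * suc r ≤ n
    lower = begin
      24 * suc r               ≡⟨ *-comm 24 (suc r) ⟩
      suc r * 24               ≤⟨ m≤n+m (suc r * 24) (n % 24) ⟩
      n % 24 + suc r * 24      ≡⟨ eq ⟨
      n                        ∎
    upper : n < 24 * (2 + r)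
    upper = begin-strict
      n                        ≡⟨ eq ⟩
      n % 24 + suc r * 24      <⟨ +-monoˡ-< (suc r * 24) (m%n<n n 24) ⟩
      (2 + r) * 24             ≡⟨ *-comm (2 + r) 24 ⟩
      24 * (2 + r)             ∎

-- The code length is `(n + suc n) * suc r`. The bound on `n` applies to both summands, as `n <` for
-- the first and `suc n ≤` for the second, which keeps the sum strict. Then
-- `48 * (2 + r) ≤ 64 * suc r` is exactly `r ≥ 2`, with equality at `r = 2`.
code-fits : ∀ n r → 2 ≤ r → n < 24 * (2 + r) → Union.codeLength n (suc n) r (8 * suc r) < 8 * suc r * (8 * suc r)
code-fits n r@(suc (suc s)) (s≤s (s≤s z≤n)) n< = begin-strict
  n + (suc n + (n * r + r * suc n))      ≡⟨ collect n r ⟩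
  (n + suc n) * suc r                    <⟨ *-monoˡ-< (suc r) (begin-strict
    n + suc n                            <⟨ +-mono-<-≤ n< n< ⟩
    24 * (2 + r) + 24 * (2 + r)          ≡⟨ constants₁ s ⟩
    192 + 48 * s                         ≤⟨ +-monoʳ-≤ 192 (*-monoˡ-≤ s 48≤64) ⟩
    192 + 64 * s                         ≡⟨ constants₂ s ⟨
    64 * suc r                           ∎) ⟩
  64 * suc r * suc r                     ≡⟨ square (suc r) ⟩
  8 * suc r * (8 * suc r)                ∎
  where
  open ≤-Reasoning
  48≤64 : 48 ≤ 64
  48≤64 = m≤m+n 48 16
  collect : ∀ n r → n + (suc n + (n * r + r * suc n)) ≡ (n + suc n) * suc r
  collect = solve-∀
  constants₁ : ∀ s → 24 * (4 + s) + 24 * (4 + s) ≡ 192 + 48 * s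
  constants₁ = solve-∀
  constants₂ : ∀ s → 64 * (3 + s) ≡ 192 + 64 * s
  constants₂ = solve-∀
  square : ∀ t → 64 * t * t ≡ 8 * t * (8 * t)
  square = solve-∀

-- The `D i` are built for every `n`, so the matrix is total and only its rigidity is conditional;
-- below 72 it is zero. The constant 48 in `n ≤ 48 * r` arises from `n < 24 * (2 + r)` and `2 ≤ r`.
matrix : ∀ n → Σ (Fin n → Fin (suc n) → Bool) λ M →
  72 ≤ n → ∃ λ r → (24 * suc r ≤ n × n ≤ 48 * r) × Union.Rigid n (suc n) r (8 * suc r) M
matrix n with 72 ≤? n
... | no  72≰n = (λ _ _ → false) , λ 72≤n → contradiction 72≤n 72≰n
... | yes 72≤n with r , 2≤r , lower , upper ← scale n 72≤n
  with M , rigid ← Union.rigid-matrix n (suc n) r (8 * suc r) (code-fits n r 2≤r upper) =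
  M , λ _ → r , (lower , (begin
    n                      ≤⟨ <⇒≤ upper ⟩
    24 * (2 + r)           ≤⟨ *-monoʳ-≤ 24 (+-monoˡ-≤ r 2≤r) ⟩
    24 * (r + r)           ≡⟨ double r ⟩
    48 * r                 ∎)) , rigid
  where
  open ≤-Reasoning
  double : ∀ r → 24 * (r + r) ≡ 48 * r
  double = solve-∀

^-cancelʳ-≤ : ∀ {r w} → 2 ^ r ≤ 2 ^ w → r ≤ w
^-cancelʳ-≤ le = ≮⇒≥ λ w<r → <⇒≱ (^-monoʳ-< 2 (s≤s (s≤s z≤n)) w<r) le

-- Assembling the bounds

module Final (n : ℕ) where

  M = proj₁ (matrix n)

  open Instance n M public
  open Hardness n M (conjOf D) conj-intro conj-elim

  module _ (72≤n : 72 ≤ n) where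

    private
      r = proj₁ (proj₂ (matrix n) 72≤n)
      24r≤n = proj₁ (proj₁ (proj₂ (proj₂ (matrix n) 72≤n)))
      n≤48r = proj₂ (proj₁ (proj₂ (proj₂ (matrix n) 72≤n)))
      rigid = proj₂ (proj₂ (proj₂ (matrix n) 72≤n))

      3θ≤n : 3 * (8 * suc r) ≤ n
      3θ≤n = ≤-trans (≤-reflexive (sym (*-assoc 3 8 (suc r)))) 24r≤n

    conj-bound : ∀ {T} (F : CSDNNF (suc (suc n + n)) T) w → Represents F (conjOf D) → HasWidth F w → 2 ^ n ≤ w ^ 48
    conj-bound F w rep hw = begin
      2 ^ n           ≤⟨ ^-monoʳ-≤ 2 n≤48r ⟩
      2 ^ (48 * r)    ≡⟨ cong (2 ^_) (*-comm 48 r) ⟩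
      2 ^ (r * 48)    ≡⟨ ^-*-assoc 2 r 48 ⟨
      (2 ^ r) ^ 48    ≤⟨ ^-monoˡ-≤ 48 (width {r} {8 * suc r} rigid (s≤s z≤n) 3θ≤n F rep hw) ⟩
      w ^ 48          ∎
      where open ≤-Reasoning

    disjNeg-bound : ∀ {T} (F : CSDNNF (suc (suc n + n)) T) w → Represents F (disjNegOf D) → HasWidth F w → n ≤ 48 * w
    disjNeg-bound F w rep hw = ≤-trans n≤48r (*-monoʳ-≤ 48 (^-cancelʳ-≤ {r} {w}
      (not-width {r} {8 * suc r} rigid (s≤s z≤n) 3θ≤n F (λ a → trans (rep a) (disjNeg-not a)) hw)))

theorem14 : ∃ λ (a : ℕ) → ∃ λ (b : ℕ) → ∃ λ (N : ℕ) → ∃ λ (k : ℕ) → 1 ≤ k ×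
    (∀ (n : ℕ) → Σ ℕ λ m → m ≤ a * n + b ×
    Σ (VTree m) λ T → Σ (Fin n → CSDNNF m T) λ D →
    (∀ i → IsDeterministic (D i)) ×
    (∀ i → HasWidth (D i) 2) ×
    (N ≤ n → ∀ (T′ : VTree m) (E : CSDNNF m T′) (w : ℕ) →
    Represents E (conjOf D) → HasWidth E w → 2 ^ n ≤ w ^ k) ×
    (Σ (VTree m) λ T′ → Σ (CSDNNF m T′) λ E → Σ ℕ λ w →
    Represents E (disjNegOf D) × HasWidth E w × w ≤ a * n + b) ×
    (N ≤ n → ∀ (T′ : VTree m) (E : CSDNNF m T′) (w : ℕ) →
    Represents E (disjNegOf D) → HasWidth E w → n ≤ k * w))
-- There are `2 * n + 2` variables, which also bounds the width `2 * n + 1` of `E`. Both lower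
-- bounds come from `n ≤ 48 * r`, valid from 72 on.
theorem14 = 2 , 2 , 72 , 48 , s≤s z≤n , λ n → let open Final n in
  suc (suc n + n) , ≤-reflexive (size-eq n) , comb (suc n + n) id , D , D-deterministic , D-width ,
  (λ 72≤n T′ → conj-bound 72≤n) ,
  (comb (suc n + n) id , E , suc (n * 2) , E-represents , E-width , width-le n) ,
  (λ 72≤n T′ → disjNeg-bound 72≤n)
  where
  size-eq : ∀ n → suc (suc n + n) ≡ 2 * n + 2
  size-eq = solve-∀
  width-le : ∀ n → suc (n * 2) ≤ 2 * n + 2
  width-le n = begin
    suc (n * 2)    ≤⟨ n≤1+n _ ⟩
    2 + n * 2      ≡⟨ +-comm 2 (n * 2) ⟩
    n * 2 + 2      ≡⟨ cong (_+ 2) (*-comm n 2) ⟩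
    2 * n + 2      ∎
    where open ≤-Reasoning
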